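{- Let $\mathcal{C}$ be a complexity class that is closed under exponential-time reductions that only ask one query which is smaller in length. Then every $\leqslant^{\mathrm{P}}_{2-\mathrm{tt}}$-complete set for $\mathcal{C}$ is $\leqslant^{\mathrm{P}}_{2-\mathrm{tt}}$-autoreducible.
   Context: Sets are subsets of $\{0,1\}^*$; a complexity class is a class of such sets. The closure hypothesis on $\mathcal{C}$ means: whenever $B \in \mathcal{C}$ and $D$ is a set decided by $N^B$ for some deterministic oracle Turing machine $N$ running in time $2^{n^{O(1)}}$ that on every input $z$ makes only one oracle query, of length smaller than $|z|$, then $D \in \mathcal{C}$. A reduction of a set $A$ to a set $B$ is a deterministic polynomial-time oracle Turing machine $M$ such that $M^B$ decides $A$. It is nonadaptive if the oracle queries $M$ makes on any input are independent of the oracle. We write $A \leqslant^{\mathrm{P}}_{2-\mathrm{tt}} B$ if there is a nonadaptive reduction of $A$ to $B$ making at most 2 oracle queries on every input. A set $C$ is $\leqslant^{\mathrm{P}}_{2-\mathrm{tt}}$-complete for $\mathcal{C}$ if $C \in \mathcal{C}$ and every set in $\mathcal{C}$ is $\leqslant^{\mathrm{P}}_{2-\mathrm{tt}}$-reducible to $C$. A set $A$ is $\leqslant^{\mathrm{P}}_{2-\mathrm{tt}}$-autoreducible if there is a $\leqslant^{\mathrm{P}}_{2-\mathrm{tt}}$-reduction $M$ of $A$ to itself that never queries its own input, i.e., for every input $x$, $x$ is not among the queries of $M$ on input $x$. -}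

module Defs where

open import Data.Bool using (Bool; true; false)
open import Data.Fin using (Fin)
open import Data.List as List using (List; []; _∷_; _++_; length; fromMaybe)
open import Data.List.Membership.Propositional using (_∉_)
open import Data.Maybe using (Maybe)
open import Data.Nat using (ℕ; suc; _+_; _^_; _≤_; _<_)
open import Data.List.Relation.Unary.All using (All)
open import Data.Product using (_×_; _,_; ∃-syntax)
open import Data.Vec as Vec using (Vec)
open import Level using (Level) renaming (suc to lsuc)
open import Relation.Binary.PropositionalEquality using (_≡_)
open import Relation.Unary using (Pred; _∈_)

Word : Set
Word = List Bool

-- A set of words, given by its characteristic function; an oracle is such a set.
Language : Set
Language = Word → Bool

ComplexityClass : (ℓ : Level) → Set (lsuc ℓ)
ComplexityClass ℓ = Pred Language ℓ

data Symbol (m : ℕ) : Set where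
  blank : Symbol m
  bit   : Bool → Symbol m
  aux   : Fin m → Symbol m

data Direction : Set where
  left stay right : Direction

-- A two-way infinite tape, blank outside the stored part.
-- `before` lists the cells to the left of the head, nearest cell first.
record Tape (m : ℕ) : Set where
  constructor tape
  field
    before  : List (Symbol m)
    scanned : Symbol m
    after   : List (Symbol m)

open Tape public

moveHead : ∀ {m} → Direction → Tape m → Tape m
moveHead stay  t                      = t
moveHead left  (tape []       s rs)   = tape [] blank (s ∷ rs)
moveHead left  (tape (l ∷ ls) s rs)   = tape ls l (s ∷ rs)
moveHead right (tape ls s [])         = tape (s ∷ ls) blank []
moveHead right (tape ls s (r ∷ rs))   = tape (s ∷ ls) r rs

writeMove : ∀ {m} → Symbol m × Direction → Tape m → Tape m
writeMove (s , d) t = moveHead d (record t { scanned = s })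

blankTape : ∀ {m} → Tape m
blankTape = tape [] blank []

-- The head scans the first bit of the word.
inputTape : ∀ {m} → Word → Tape m
inputTape []      = blankTape
inputTape (b ∷ w) = tape [] (bit b) (List.map bit w)

-- The role of a state in a machine with k work tapes, m auxiliary tape symbols
-- and q states.  An ordinary state carries its part of the transition table:
-- given the scanned symbols, the new state, what to write and how to move on
-- each work tape, and possibly a bit to append to the write-only query tape.
-- A query state names the successor states for answers "yes" and "no".
data StateKind (k m q : ℕ) : Set where
  halting  : (accept : Bool) → StateKind k m q
  querying : (yes no : Fin q) → StateKind k m q
  ordinary : (Vec (Symbol m) k →
              Fin q × Vec (Symbol m × Direction) k × Maybe Bool) →
             StateKind k m q

record OracleTM : Set where
  field
    extraTapes : ℕ
    auxSymbols : ℕ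
    states     : ℕ
    start      : Fin states
    kind       : Fin states → StateKind (suc extraTapes) auxSymbols states

record Config (M : OracleTM) : Set where
  constructor config
  open OracleTM M
  field
    state     : Fin states
    tapes     : Vec (Tape auxSymbols) (suc extraTapes)
    queryTape : Word

initial : (M : OracleTM) → Word → Config M
initial M x = config start (inputTape x Vec.∷ Vec.replicate extraTapes blankTape) []
  where open OracleTM M

data Step (M : OracleTM) : Set where
  halt : Bool → Step M
  ask  : Word → (Bool → Config M) → Step M
  next : Config M → Step M

-- Asking a query erases the query tape.
step : (M : OracleTM) → Config M → Step M
step M (config s ts w) with OracleTM.kind M s
... | halting b       = halt b
... | querying yes no = ask w λ { true → config yes ts [] ; false → config no ts [] }
... | ordinary δ with δ (Vec.map scanned ts)
...   | s′ , acts , out =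
        next (config s′ (Vec.zipWith writeMove acts ts) (w ++ fromMaybe out))

-- Run M B c t qs b: with oracle B and from configuration c, M halts after
-- exactly t steps with verdict b, having asked the queries qs in this order.
data Run (M : OracleTM) (B : Language) : Config M → ℕ → List Word → Bool → Set where
  halted  : ∀ {c b} → step M c ≡ halt b → Run M B c 0 [] b
  asked   : ∀ {c w κ t qs b} → step M c ≡ ask w κ →
            Run M B (κ (B w)) t qs b → Run M B c (suc t) (w ∷ qs) b
  stepped : ∀ {c c′ t qs b} → step M c ≡ next c′ →
            Run M B c′ t qs b → Run M B c (suc t) qs b

RunOn : OracleTM → Language → Word → ℕ → List Word → Bool → Set
RunOn M B x = Run M B (initial M x)

Decides : OracleTM → Language → Language → Set
Decides M B A = ∀ x → ∃[ t ] ∃[ qs ] RunOn M B x t qs (A x)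

-- As usual for oracle machines, the bound holds for every oracle.
RunsInTime : OracleTM → (ℕ → ℕ) → Set
RunsInTime M f =
  ∀ B x → ∃[ t ] ∃[ qs ] ∃[ b ] (RunOn M B x t qs b × t ≤ f (length x))

-- Every polynomial is bounded by n ^ c + c for some c; the summand c takes
-- care of inputs of length 0 and 1.
PolynomialTime : OracleTM → Set
PolynomialTime M = ∃[ c ] RunsInTime M (λ n → n ^ c + c)

ExponentialTime : OracleTM → Set
ExponentialTime M = ∃[ c ] RunsInTime M (λ n → 2 ^ (n ^ c + c))

-- P x qs holds for the sequence qs of queries made on any input x, whatever
-- the oracle.
QueriesSatisfy : OracleTM → (Word → List Word → Set) → Set
QueriesSatisfy M P = ∀ {B x t qs b} → RunOn M B x t qs b → P x qs

AtMostQueries : ℕ → OracleTM → Set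
AtMostQueries k M = QueriesSatisfy M λ x qs → length qs ≤ k

ShorterQueries : OracleTM → Set
ShorterQueries M = QueriesSatisfy M λ x qs → All (λ w → length w < length x) qs

NeverQueriesInput : OracleTM → Set
NeverQueriesInput M = QueriesSatisfy M λ x qs → x ∉ qs

Nonadaptive : OracleTM → Set
Nonadaptive M = ∀ {B B′ x t t′ qs qs′ b b′} →
  RunOn M B x t qs b → RunOn M B′ x t′ qs′ b′ → qs ≡ qs′

record Is2ttReduction (M : OracleTM) (A B : Language) : Set where
  field
    polynomialTime : PolynomialTime M
    decides        : Decides M B A
    nonadaptive    : Nonadaptive M
    atMostTwo      : AtMostQueries 2 M

infix 4 _≤ᴾ₂ₜₜ_

_≤ᴾ₂ₜₜ_ : Language → Language → Set
A ≤ᴾ₂ₜₜ B = ∃[ M ] Is2ttReduction M A B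

2ttComplete : ∀ {ℓ} → ComplexityClass ℓ → Language → Set ℓ
2ttComplete 𝒞 C = C ∈ 𝒞 × (∀ A → A ∈ 𝒞 → A ≤ᴾ₂ₜₜ C)

2ttAutoreducible : Language → Set
2ttAutoreducible A = ∃[ M ] (Is2ttReduction M A A × NeverQueriesInput M)

-- "One query" has to mean at most one: on the empty input there is no shorter
-- word to ask about.
ClosedUnderShorterQueryExpReductions : ∀ {ℓ} → ComplexityClass ℓ → Set ℓ
ClosedUnderShorterQueryExpReductions 𝒞 =
  ∀ B D → B ∈ 𝒞 → (N : OracleTM) →
  ExponentialTime N → AtMostQueries 1 N → ShorterQueries N →
  Decides N B D → D ∈ 𝒞

{-# OPTIONS --safe #-}
module Submission where

-- Let D be the following diagonal set. On z = w ++ x, where w describes a 2-tt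
-- reduction M, run M on z with every query answered by a = A(x); if M queried x, D
-- takes the opposite of the verdict, and otherwise a. This takes exponential time and
-- the single query x, so D has a 2-tt reduction M to A; let w describe this M. If M
-- on z does not query x, its verdict D(z) is A(x). If it queries x and at most one
-- other word y, then A(y) = A(x) would make the real answers all equal to A(x), and the
-- verdict its own opposite; hence A(x) = ¬ A(y). Either way A(x) is found by running M
-- on z and asking only the queries other than x.
--
-- To interpret M, its tapes are laid out on the queue of a one-queue machine, which a
-- universal machine runs for 2^|z| rounds. The word w is padded so that this exceeds
-- the polynomial running time of M.

open import Level using (Level)
open import Defs
open import Data.Bool using (Bool; true; false; not; if_then_else_)
open import Data.Empty using (⊥-elim)
open import Data.Fin as Fin using (Fin; zero; suc; toℕ)
import Data.Fin.Properties as Fin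
open import Data.List as List using (List; []; _∷_; _++_; _ʳ++_; length; fromMaybe; reverse; replicate)
import Data.List.Properties as List
open import Data.List.Membership.Propositional using (_∉_)
open import Data.List.Relation.Unary.All as All using (All; []; _∷_)
open import Data.List.Relation.Unary.Any using (here; there)
open import Data.Maybe using (Maybe; just; nothing)
open import Data.Nat using (ℕ; zero; suc; pred; _+_; _*_; _∸_; _^_; _≤_; _<_; z≤n; s≤s)
open import Data.Nat.DivMod
open import Data.Nat.Properties
open import Data.Nat.Tactic.RingSolver using (solve-∀)
open import Data.Product using (_×_; _,_; proj₁; proj₂; ∃-syntax; map₁)
open import Data.Sum using (_⊎_; inj₁; inj₂)
open import Data.Unit using (⊤; tt)
open import Data.Vec as Vec using (Vec; []; _∷_)
import Data.Vec.Properties as Vec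
open import Function using (_∘_; id)
open import Relation.Binary.PropositionalEquality
open import Relation.Nullary using (¬_; Dec; yes; no; does)

-- D must be fixed before M is known, since M comes from completeness applied to D. So D reads M off
-- its input and needs an interpreter with one exponential time bound for all M, although the
-- degrees of their polynomials are unbounded: a clock of |z| bits cuts off every run, and padding
-- makes it long enough for the one M used in the end. Descriptions are self-delimiting and
-- nonempty, so the word x queried by D is shorter than z.
--
-- Nonadaptivity makes the final comparison possible. M asks the same words under three oracles: the
-- real one, the constant A(x), and the one the autoreduction can afford, with `false` at x. Only
-- the verdicts may differ.
--
-- `Interception` serves twice: with constant answers it is the procedure that D has interpreted,
-- with other words forwarded it is the core of the autoreduction. The queue form turns the tapes,
-- symbols and states of M into one finite table, whose rows are found by adding a number for the
-- state to one for the glyph.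

record Finite (A : Set) : Set where
  field
    size          : ℕ
    index         : A → Fin size
    element       : Fin size → A
    element-index : ∀ a → element (index a) ≡ a

open Finite

-- Only one composite has to be the identity: a machine may have spare state numbers, so an
-- injective coding is enough.
retract : ∀ {A B : Set} (f : A → B) (g : B → A) → (∀ a → g (f a) ≡ a) → Finite B → Finite A
retract f g gf F = record
  { size = size F ; index = index F ∘ f ; element = g ∘ element F
  ; element-index = λ a → trans (cong g (element-index F (f a))) (gf a) }

finite-Fin : ∀ n → Finite (Fin n)
finite-Fin n = record { size = n ; index = id ; element = id ; element-index = λ _ → refl }

infixr 2 _finite-×_
infixr 1 _finite-⊎_

_finite-×_ : ∀ {A B} → Finite A → Finite B → Finite (A × B)
_finite-×_ F G = record
  { size = size F * size G
  ; index = λ (a , b) → Fin.combine (index F a) (index G b)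
  ; element = λ i → let j , k = Fin.remQuot (size G) i in element F j , element G k
  ; element-index = λ (a , b) →
      trans (cong (λ (j , k) → element F j , element G k) (Fin.remQuot-combine (index F a) (index G b)))
            (cong₂ _,_ (element-index F a) (element-index G b)) }

_finite-⊎_ : ∀ {A B} → Finite A → Finite B → Finite (A ⊎ B)
_finite-⊎_ {A} {B} F G = record
  { size = size F + size G
  ; index = λ x → Fin.join (size F) (size G) (Data.Sum.map (index F) (index G) x)
  ; element = λ i → Data.Sum.map (element F) (element G) (Fin.splitAt (size F) i)
  ; element-index = λ x →
      trans (cong (Data.Sum.map (element F) (element G)) (Fin.splitAt-join (size F) (size G) (Data.Sum.map (index F) (index G) x)))
            (back x) }
  where
  back : ∀ x → Data.Sum.map (element F) (element G) (Data.Sum.map (index F) (index G) x) ≡ x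
  back (inj₁ a) = cong inj₁ (element-index F a)
  back (inj₂ b) = cong inj₂ (element-index G b)

finite-⊤ : Finite ⊤
finite-⊤ = record { size = 1 ; index = λ _ → zero ; element = λ _ → tt ; element-index = λ _ → refl }

finite-Bool : Finite Bool
finite-Bool = record
  { size = 2 ; index = λ { false → zero ; true → suc zero }
  ; element = λ { zero → false ; (suc zero) → true }
  ; element-index = λ { false → refl ; true → refl } }

finite-Vec : ∀ {A} → Finite A → ∀ n → Finite (Vec A n)
finite-Vec F zero    = retract (λ _ → tt) (λ _ → []) (λ { [] → refl }) finite-⊤
finite-Vec F (suc n) = retract (λ { (a ∷ v) → a , v }) (λ (a , v) → a ∷ v) (λ { (a ∷ v) → refl }) (F finite-× finite-Vec F n)

finite-Symbol : ∀ m → Finite (Symbol m)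
finite-Symbol m = retract
  (λ { blank → inj₁ tt ; (bit b) → inj₂ (inj₁ b) ; (aux i) → inj₂ (inj₂ i) })
  (λ { (inj₁ tt) → blank ; (inj₂ (inj₁ b)) → bit b ; (inj₂ (inj₂ i)) → aux i })
  (λ { blank → refl ; (bit b) → refl ; (aux i) → refl })
  (finite-⊤ finite-⊎ finite-Bool finite-⊎ finite-Fin m)

finite-Direction : Finite Direction
finite-Direction = retract
  (λ { left → zero ; stay → suc zero ; right → suc (suc zero) })
  (λ { zero → left ; (suc zero) → stay ; (suc (suc zero)) → right })
  (λ { left → refl ; stay → refl ; right → refl })
  (finite-Fin 3)

-- Machines over an arbitrary state type

data Kind (k m : ℕ) (S : Set) : Set where
  halting  : Bool → Kind k m S
  querying : (Bool → S) → Kind k m S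
  ordinary : (Vec (Symbol m) k → S × Vec (Symbol m × Direction) k × Maybe Bool) → Kind k m S

record Conf (k m : ℕ) (S : Set) : Set where
  constructor conf
  field
    control : S
    works   : Vec (Tape m) k
    pending : Word

data Outcome (k m : ℕ) (S : Set) : Set where
  stop    : Bool → Outcome k m S
  consult : Word → (Bool → Conf k m S) → Outcome k m S
  goto    : Conf k m S → Outcome k m S

perform : ∀ {k m S} → Kind k m S → Vec (Tape m) k → Word → Outcome k m S
perform (halting b)  ts w = stop b
perform (querying κ) ts w = consult w λ b → conf (κ b) ts []
perform (ordinary f) ts w =
  let s , acts , out = f (Vec.map scanned ts)
  in goto (conf s (Vec.zipWith writeMove acts ts) (w ++ fromMaybe out))

module _ {k m : ℕ} {S : Set} (δ : S → Kind k m S) where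

  outcome : Conf k m S → Outcome k m S
  outcome (conf s ts w) = perform (δ s) ts w

  -- The index t is only an upper bound on the number of steps.
  data Reach (B : Language) : Conf k m S → ℕ → List Word → Conf k m S → Set where
    arrived : ∀ {c t} → Reach B c t [] c
    move    : ∀ {c c′ d t qs} → outcome c ≡ goto c′ → Reach B c′ t qs d → Reach B c (suc t) qs d
    query   : ∀ {c w κ d t qs} → outcome c ≡ consult w κ → Reach B (κ (B w)) t qs d →
              Reach B c (suc t) (w ∷ qs) d

  Halts : Language → Conf k m S → ℕ → List Word → Bool → Set
  Halts B c t qs b = ∃[ d ] (Reach B c t qs d × outcome d ≡ stop b)

module _ {k m : ℕ} {S : Set} {δ : S → Kind k m S} {B : Language} where

  relax : ∀ {c d t t′ qs} → t ≤ t′ → Reach δ B c t qs d → Reach δ B c t′ qs d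
  relax t≤t′       arrived     = arrived
  relax (s≤s t≤t′) (move e r)  = move e (relax t≤t′ r)
  relax (s≤s t≤t′) (query e r) = query e (relax t≤t′ r)

  infixr 5 _▷_
  _▷_ : ∀ {c d e t t′ qs qs′} → Reach δ B c t qs d → Reach δ B d t′ qs′ e →
        Reach δ B c (t + t′) (qs ++ qs′) e
  _▷_ {t = t} arrived r = relax (m≤n+m _ t) r
  move e r  ▷ r′ = move e (r ▷ r′)
  query e r ▷ r′ = query e (r ▷ r′)

  infixr 5 _▷ʰ_
  _▷ʰ_ : ∀ {c d t t′ qs qs′ b} → Reach δ B c t qs d → Halts δ B d t′ qs′ b →
         Halts δ B c (t + t′) (qs ++ qs′) b
  r ▷ʰ (d , r′ , e) = d , r ▷ r′ , e

  relaxʰ : ∀ {c t t′ qs b} → t ≤ t′ → Halts δ B c t qs b → Halts δ B c t′ qs b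
  relaxʰ t≤t′ (d , r , e) = d , relax t≤t′ r , e

module _ {k m : ℕ} {S S′ : Set} (f : S → S′) where

  mapKind : Kind k m S → Kind k m S′
  mapKind (halting b)  = halting b
  mapKind (querying κ) = querying (f ∘ κ)
  mapKind (ordinary g) = ordinary (map₁ f ∘ g)

  mapConf : Conf k m S → Conf k m S′
  mapConf (conf s ts w) = conf (f s) ts w

  module _ {δ : S → Kind k m S} {δ′ : S′ → Kind k m S′} (δ-f : ∀ s → δ′ (f s) ≡ mapKind (δ s)) where

    map-stop : ∀ {c b} → outcome δ c ≡ stop b → outcome δ′ (mapConf c) ≡ stop b
    map-stop {conf s ts w} e rewrite δ-f s with δ s
    map-stop refl | halting b = refl

    map-goto : ∀ {c c′} → outcome δ c ≡ goto c′ → outcome δ′ (mapConf c) ≡ goto (mapConf c′)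
    map-goto {conf s ts w} e rewrite δ-f s with δ s
    map-goto refl | ordinary g = refl

    map-consult : ∀ {c w κ} → outcome δ c ≡ consult w κ →
                  outcome δ′ (mapConf c) ≡ consult w (mapConf ∘ κ)
    map-consult {conf s ts w} e rewrite δ-f s with δ s
    map-consult refl | querying κ = refl

    map-reach : ∀ {B c t qs d} → Reach δ B c t qs d → Reach δ′ B (mapConf c) t qs (mapConf d)
    map-reach arrived     = arrived
    map-reach (move e r)  = move (map-goto e) (map-reach r)
    map-reach (query e r) = query (map-consult e) (map-reach r)

    map-halts : ∀ {B c t qs b} → Halts δ B c t qs b → Halts δ′ B (mapConf c) t qs b
    map-halts (d , r , e) = mapConf d , map-reach r , map-stop e

module _ {k m : ℕ} {S : Set} (F : Finite S) (s₀ : S) (δ : S → Kind (suc k) m S) where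

  stateKind : Kind (suc k) m S → StateKind (suc k) m (size F)
  stateKind (halting b)  = halting b
  stateKind (querying κ) = querying (index F (κ true)) (index F (κ false))
  stateKind (ordinary f) = ordinary (map₁ (index F) ∘ f)

  machine : OracleTM
  machine = record
    { extraTapes = k ; auxSymbols = m ; states = size F
    ; start = index F s₀ ; kind = λ i → stateKind (δ (element F i)) }

  private
    embed : Conf (suc k) m S → Config machine
    embed (conf s ts w) = config (index F s) ts w

    embed-stop : ∀ {c b} → outcome δ c ≡ stop b → step machine (embed c) ≡ halt b
    embed-stop {conf s ts w} e rewrite element-index F s with δ s
    embed-stop refl | halting b = refl

    embed-goto : ∀ {c c′} → outcome δ c ≡ goto c′ → step machine (embed c) ≡ next (embed c′)
    embed-goto {conf s ts w} e rewrite element-index F s with δ s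
    embed-goto refl | ordinary f = refl

    embed-consult : ∀ {c w κ} → outcome δ c ≡ consult w κ →
      ∃[ κ′ ] (step machine (embed c) ≡ ask w κ′ × ∀ b → κ′ b ≡ embed (κ b))
    embed-consult {conf s ts w} e rewrite element-index F s with δ s
    embed-consult refl | querying κ = _ , refl , λ { true → refl ; false → refl }

    embed-reach : ∀ {B c t qs d b} → Reach δ B c t qs d → outcome δ d ≡ stop b →
      ∃[ t′ ] (Run machine B (embed c) t′ qs b × t′ ≤ t)
    embed-reach arrived e = 0 , halted (embed-stop e) , z≤n
    embed-reach (move e r) e′ =
      let t , run , le = embed-reach r e′ in suc t , stepped (embed-goto e) run , s≤s le
    embed-reach {B} (query {w = w} e r) e′ =
      let t , run , le    = embed-reach r e′
          κ′ , eq , κ′≗κ = embed-consult e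
      in suc t , asked eq (subst (λ c → Run machine B c t _ _) (sym (κ′≗κ (B w))) run) , s≤s le

  machine-run : ∀ {B x t qs b} →
    Halts δ B (conf s₀ (inputTape x ∷ Vec.replicate k blankTape) []) t qs b →
    ∃[ t′ ] (RunOn machine B x t′ qs b × t′ ≤ t)
  machine-run (d , r , e) = embed-reach r e

-- Runs: determinism and dependence on the oracle

run-deterministic : ∀ {M B c t t′ qs qs′ b b′} →
  Run M B c t qs b → Run M B c t′ qs′ b′ → qs ≡ qs′ × b ≡ b′
run-deterministic (halted e) (halted e′) with refl ← trans (sym e) e′ = refl , refl
run-deterministic (halted e) (asked e′ r′) with () ← trans (sym e) e′
run-deterministic (halted e) (stepped e′ r′) with () ← trans (sym e) e′
run-deterministic (asked e r) (halted e′) with () ← trans (sym e) e′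
run-deterministic (asked e r) (asked e′ r′) with refl ← trans (sym e) e′ =
  let eq , eq′ = run-deterministic r r′ in cong (_ ∷_) eq , eq′
run-deterministic (asked e r) (stepped e′ r′) with () ← trans (sym e) e′
run-deterministic (stepped e r) (halted e′) with () ← trans (sym e) e′
run-deterministic (stepped e r) (asked e′ r′) with () ← trans (sym e) e′
run-deterministic (stepped e r) (stepped e′ r′) with refl ← trans (sym e) e′ =
  run-deterministic r r′

-- Nonadaptivity fixes the queries but not the verdict. This lemma carries a verdict from one oracle
-- to another that agrees with it on the words actually asked.
run-agree : ∀ {M B B′ c t qs b} → All (λ w → B w ≡ B′ w) qs →
  Run M B c t qs b → Run M B′ c t qs b
run-agree [] (halted e) = halted e
run-agree ps (stepped e r) = stepped e (run-agree ps r)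
run-agree {M} {B′ = B′} (p ∷ ps) (asked {κ = κ} e r) =
  asked e (subst (λ a → Run M B′ (κ a) _ _ _) p (run-agree ps r))

-- Words on tapes

⌜_⌝ : ∀ {m} → Word → List (Symbol m)
⌜_⌝ = List.map bit

idle : ∀ {k m} (ts : Vec (Tape m) k) →
  Vec.zipWith writeMove (Vec.map (_, stay) (Vec.map scanned ts)) ts ≡ ts
idle []       = refl
idle (t ∷ ts) = cong (t ∷_) (idle ts)

≤-slack : ∀ {a b} d → a + d ≡ b → a ≤ b
≤-slack {a} d e = subst (a ≤_) e (m≤m+n a d)

-- Sweeps to the left turn back at the delimiting blank, so `base` may hold any debris: earlier
-- queries on one tape, popped cells on another.
module Cursor {A : Set} {m : ℕ} (f : A → Symbol m) (base : List (Symbol m)) where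

  -- The tape holding, to the right of a blank, the reversal of u followed by r,
  -- with the head on the first symbol of r.
  cursor : List A → List A → Tape m
  cursor u []      = tape (List.map f u ++ blank ∷ base) blank []
  cursor u (a ∷ r) = tape (List.map f u ++ blank ∷ base) (f a) (List.map f r ++ blank ∷ [])

  leftOf : List A → List A → Tape m
  leftOf []      r = tape base blank (List.map f r ++ blank ∷ [])
  leftOf (a ∷ u) r = cursor u (a ∷ r)

  cursor-right : ∀ u a r → moveHead right (cursor u (a ∷ r)) ≡ cursor (a ∷ u) r
  cursor-right u a []      = refl
  cursor-right u a (b ∷ r) = refl

  cursor-left : ∀ u r → moveHead left (cursor u r) ≡ leftOf u r
  cursor-left []      []      = refl
  cursor-left []      (b ∷ r) = refl
  cursor-left (a ∷ u) []      = refl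
  cursor-left (a ∷ u) (b ∷ r) = refl

  leftOf-right : ∀ u r → moveHead right (leftOf u r) ≡ cursor u r
  leftOf-right []      []      = refl
  leftOf-right []      (b ∷ r) = refl
  leftOf-right (a ∷ u) []      = refl
  leftOf-right (a ∷ u) (b ∷ r) = refl

-- The input tape while it is read for the first time: not yet delimited by blanks.
reading : ∀ {m} → Word → Word → Tape m
reading u []      = tape ⌜ u ⌝ blank []
reading u (b ∷ r) = tape ⌜ u ⌝ (bit b) ⌜ r ⌝

reading-right : ∀ {m} u b r → moveHead right (reading {m} u (b ∷ r)) ≡ reading (b ∷ u) r
reading-right u b []      = refl
reading-right u b (_ ∷ _) = refl

backing : ∀ {m} → Word → Word → Tape m
backing []      r = tape [] blank (⌜ r ⌝ ++ blank ∷ [])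
backing (b ∷ u) r = tape ⌜ u ⌝ (bit b) (⌜ r ⌝ ++ blank ∷ [])

reading-end : ∀ {m} u → moveHead left (reading {m} u []) ≡ backing u []
reading-end []      = refl
reading-end (_ ∷ _) = refl

backing-left : ∀ {m} b u r → moveHead left (backing {m} (b ∷ u) r) ≡ backing u (b ∷ r)
backing-left b []      r = refl
backing-left b (_ ∷ _) r = refl

reading-input : ∀ {m} z → reading {m} [] z ≡ inputTape z
reading-input []      = refl
reading-input (_ ∷ _) = refl

infix 4 _≟ʷ_
_≟ʷ_ : (u v : Word) → Dec (u ≡ v)
_≟ʷ_ = List.≡-dec Data.Bool._≟_

reverse-≟ : ∀ u v → does (reverse u ≟ʷ reverse v) ≡ does (u ≟ʷ v)
reverse-≟ u v with u ≟ʷ v | reverse u ≟ʷ reverse v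
... | yes _   | yes _ = refl
... | no _    | no _  = refl
... | yes u≡v | no ¬p = ⊥-elim (¬p (cong reverse u≡v))
... | no u≢v  | yes p = ⊥-elim (u≢v (List.reverse-injective p))

-- Simulating a reduction with its queries intercepted

data Label : Set where
  running comparing returning rewinding copying asking : Label

finite-Label : Finite Label
finite-Label = retract
  (λ { running → Fin.# 0 ; comparing → Fin.# 1 ; returning → Fin.# 2
     ; rewinding → Fin.# 3 ; copying → Fin.# 4 ; asking → Fin.# 5 })
  (Vec.lookup (running ∷ comparing ∷ returning ∷ rewinding ∷ copying ∷ asking ∷ []))
  (λ { running → refl ; comparing → refl ; returning → refl
     ; rewinding → refl ; copying → refl ; asking → refl })
  (finite-Fin 6)

-- `just a` answers every query by a; `nothing` asks the oracle, except that the
-- distinguished word is answered `false`.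
Mode : Set
Mode = Maybe Bool

answer : Mode → Language → Word → Language
answer (just a) B x w = a
answer nothing  B x w = if does (w ≟ʷ x) then false else B w

forwarded : Mode → Word → List Word → List Word
forwarded mode     x []       = []
forwarded (just a) x (w ∷ qs) = forwarded (just a) x qs
forwarded nothing  x (w ∷ qs) = if does (w ≟ʷ x) then forwarded nothing x qs else w ∷ forwarded nothing x qs

flagged : Word → Bool → List Word → Bool
flagged x fl []       = fl
flagged x fl (w ∷ qs) = flagged x (if does (w ≟ʷ x) then true else fl) qs

-- In mode `nothing` the initial `la` survives only if no word other than `x` is asked. If `x` alone
-- is asked, the constant answers are the real ones, a case that diagonalization excludes; with no
-- query at all, `verdict` does not look at it.
lastAnswer : Mode → Language → Word → Bool → List Word → Bool
lastAnswer mode     B x la []       = la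
lastAnswer (just a) B x la (w ∷ qs) = lastAnswer (just a) B x la qs
lastAnswer nothing  B x la (w ∷ qs) = lastAnswer nothing B x (if does (w ≟ʷ x) then la else B w) qs

-- For `just a` this is the rule defining the diagonal set; for `nothing` it recovers A(x) from that
-- rule.
verdict : Mode → Bool → Bool → Bool → Bool
verdict (just a) fl la v = if fl then not v else a
verdict nothing  fl la v = if fl then not la else v

-- M run with its queries collected on a second tape and compared there with the
-- word on the first tape; only other words are passed on to the oracle.
module Interception (M : OracleTM) where

  private
    k m Q : ℕ
    k = suc (OracleTM.extraTapes M)
    m = OracleTM.auxSymbols M
    Q = OracleTM.states M

  -- The Booleans: whether x has been queried, the last answer of the oracle, and
  -- whether the last two words compared were equal.
  Control : Set
  Control = Label × Fin Q × (Bool × Bool × Bool)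

  finite-Control : Finite Control
  finite-Control = finite-Label finite-× finite-Fin Q finite-× finite-Bool finite-× finite-Bool finite-× finite-Bool

  -- The control carries the querying state itself through the comparison and chooses its successor
  -- only once the answer is known.
  select : StateKind k m Q → Fin Q → Bool → Fin Q
  select (querying y n) s b = if b then y else n
  select _                 s b = s

  resume : Fin Q → Bool → Fin Q
  resume s = select (OracleTM.kind M s) s

  ctl : ∀ {S : Set} → (Symbol m → Symbol m → S × (Symbol m × Direction) × (Symbol m × Direction) × Maybe Bool) →
        Kind (2 + k) m S
  ctl f = ordinary λ v →
    let s , a , b , out = f (Vec.head v) (Vec.head (Vec.tail v))
    in s , a ∷ b ∷ Vec.map (_, stay) (Vec.tail (Vec.tail v)) , out

  record-output : Symbol m → Maybe Bool → Symbol m × Direction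
  record-output s nothing  = s , stay
  record-output s (just b) = bit b , right

  runKind : Mode → StateKind k m Q → Fin Q → Bool → Bool → Bool → Kind (2 + k) m Control
  runKind mode (halting v)    s fl la eq = halting (verdict mode fl la v)
  runKind mode (querying _ _) s fl la eq =
    ctl λ x w → (comparing , s , fl , la , eq) , (x , left) , (w , left) , nothing
  runKind mode (ordinary f)   s fl la eq = ordinary λ v →
    let x = Vec.head v
        w = Vec.head (Vec.tail v)
        s′ , acts , out = f (Vec.tail (Vec.tail v))
    in (running , s′ , fl , la , eq) , (x , stay) ∷ record-output w out ∷ acts , nothing

  finish : Mode → Fin Q → Bool → Bool → Bool → Control
  finish (just a) s fl la true  = running , resume s a , true , la , true
  -- Any constant would do as the answer for x: the queries stay the same by nonadaptivity, and the
  -- verdict of M is discarded once the flag is set.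
  finish nothing  s fl la true  = running , resume s false , true , la , true
  finish (just a) s fl la false = running , resume s a , fl , la , false
  finish nothing  s fl la false = asking , s , fl , la , false

  kind : Mode → Control → Kind (2 + k) m Control
  kind mode (running , s , fl , la , eq) = runKind mode (OracleTM.kind M s) s fl la eq
  kind mode (comparing , s , fl , la , eq) = ctl λ
    { (bit true)  (bit true)  → (comparing , s , fl , la , eq) , (bit true , left) , (bit true , left) , nothing
    ; (bit false) (bit false) → (comparing , s , fl , la , eq) , (bit false , left) , (bit false , left) , nothing
    ; blank       blank       → (returning , s , fl , la , true) , (blank , right) , (blank , stay) , nothing
    ; x           w           → (returning , s , fl , la , false) , (x , right) , (w , stay) , nothing }
  kind mode (returning , s , fl , la , eq) = ctl λ
    { (bit b) w → (returning , s , fl , la , eq) , (bit b , right) , (w , stay) , nothing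
    ; x       w → (rewinding , s , fl , la , eq) , (x , stay) , (w , stay) , nothing }
  kind mode (rewinding , s , fl , la , eq) = ctl λ
    { x (bit b) → (rewinding , s , fl , la , eq) , (x , stay) , (bit b , left) , nothing
    ; x w       → (copying , s , fl , la , eq) , (x , stay) , (w , right) , nothing }
  -- A word equal to x is swept over as well, without output: the head has to get behind it, where
  -- the next query is recorded after a fresh blank.
  kind mode (copying , s , fl , la , eq) = ctl λ
    { x (bit b) → (copying , s , fl , la , eq) , (x , stay) , (bit b , right) , (if eq then nothing else just b)
    ; x w       → finish mode s fl la eq , (x , stay) , (w , right) , nothing }
  kind mode (asking , s , fl , la , eq) = querying λ b → running , resume s b , fl , b , eq

  module _ (mode : Mode) (B : Language) (x : Word) (baseX : List (Symbol m)) where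

    private
      module X = Cursor {m = m} bit baseX
      Re = Reach (kind mode) B

    emit : ∀ {c s X₁ W₁ X₂ W₂ w t qs d} {ts : Vec (Tape m) k} →
      outcome (kind mode) c ≡ goto (conf s (X₁ ∷ W₁ ∷ Vec.zipWith writeMove (Vec.map (_, stay) (Vec.map scanned ts)) ts) w) →
      X₁ ≡ X₂ → W₁ ≡ W₂ → Re (conf s (X₂ ∷ W₂ ∷ ts) w) t qs d → Re c (suc t) qs d
    emit {ts = ts} e refl refl r = move e (subst (λ ts → Re (conf _ (_ ∷ _ ∷ ts) _) _ _ _) (sym (idle ts)) r)

    still : ∀ {c s X₁ W₁ X₂ W₂ w t qs d} {ts : Vec (Tape m) k} →
      outcome (kind mode) c ≡ goto (conf s (X₁ ∷ W₁ ∷ Vec.zipWith writeMove (Vec.map (_, stay) (Vec.map scanned ts)) ts) (w ++ [])) →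
      X₁ ≡ X₂ → W₁ ≡ W₂ → Re (conf s (X₂ ∷ W₂ ∷ ts) w) t qs d → Re c (suc t) qs d
    still {w = w} e eX eW r = emit e eX eW (subst (λ w → Re (conf _ _ w) _ _ _) (sym (List.++-identityʳ w)) r)

    module _ (s : Fin Q) (fl la : Bool) (ts : Vec (Tape m) k) (baseW : List (Symbol m)) where

      private
        module W = Cursor {m = m} bit baseW

      -- The place of the first mismatch is left unspecified. That `r ʳ++ u` and `p ʳ++ v` are
      -- preserved is all the later sweeps need in order to restore the heads.
      compare-words : ∀ {eq q} u v r p → ∃[ u′ ] ∃[ v′ ] ∃[ r′ ] ∃[ p′ ]
        (Re (conf (comparing , s , fl , la , eq) (X.leftOf u r ∷ W.leftOf v p ∷ ts) q)
            (suc (length u)) []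
            (conf (returning , s , fl , la , does (v ≟ʷ u)) (X.cursor u′ r′ ∷ W.leftOf v′ p′ ∷ ts) q)
         × r′ ʳ++ u′ ≡ r ʳ++ u × p′ ʳ++ v′ ≡ p ʳ++ v)
      compare-words [] [] r p =
        [] , [] , r , p , still refl (X.leftOf-right [] r) refl arrived , refl , refl
      compare-words [] (b ∷ v) r p =
        [] , b ∷ v , r , p , still refl (X.leftOf-right [] r) refl arrived , refl , refl
      compare-words (true ∷ u) [] r p =
        true ∷ u , [] , r , p , still refl (X.leftOf-right (true ∷ u) r) refl arrived , refl , refl
      compare-words (false ∷ u) [] r p =
        false ∷ u , [] , r , p , still refl (X.leftOf-right (false ∷ u) r) refl arrived , refl , refl
      compare-words (true ∷ u) (false ∷ v) r p =
        true ∷ u , false ∷ v , r , p , still refl (X.leftOf-right (true ∷ u) r) refl arrived , refl , refl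
      compare-words (false ∷ u) (true ∷ v) r p =
        false ∷ u , true ∷ v , r , p , still refl (X.leftOf-right (false ∷ u) r) refl arrived , refl , refl
      compare-words (true ∷ u) (true ∷ v) r p =
        let u′ , v′ , r′ , p′ , run , e , e′ = compare-words u v (true ∷ r) (true ∷ p)
        in u′ , v′ , r′ , p′ , still refl (X.cursor-left u (true ∷ r)) (W.cursor-left v (true ∷ p)) run , e , e′
      compare-words (false ∷ u) (false ∷ v) r p =
        let u′ , v′ , r′ , p′ , run , e , e′ = compare-words u v (false ∷ r) (false ∷ p)
        in u′ , v′ , r′ , p′ , still refl (X.cursor-left u (false ∷ r)) (W.cursor-left v (false ∷ p)) run , e , e′

      return : ∀ {eq q W U} u r → r ʳ++ u ≡ U →
        Re (conf (returning , s , fl , la , eq) (X.cursor u r ∷ W ∷ ts) q) (suc (length r)) []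
           (conf (rewinding , s , fl , la , eq) (X.cursor U [] ∷ W ∷ ts) q)
      return u []      refl = still refl refl refl arrived
      return u (a ∷ r) e    = still refl (X.cursor-right u a r) refl (return (a ∷ u) r e)

      rewind : ∀ {eq q u P} v p → v ʳ++ p ≡ P →
        Re (conf (rewinding , s , fl , la , eq) (X.cursor u [] ∷ W.leftOf v p ∷ ts) q) (suc (length v)) []
           (conf (copying , s , fl , la , eq) (X.cursor u [] ∷ W.cursor [] P ∷ ts) q)
      rewind []      p refl = still refl refl (W.leftOf-right [] p) arrived
      rewind (b ∷ v) p e    = still refl refl (W.cursor-left v (b ∷ p)) (rewind v (b ∷ p) e)

      copy-unless : ∀ {u V q′} eq v p q → p ʳ++ v ≡ V → q ++ (if eq then [] else p) ≡ q′ →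
        Re (conf (copying , s , fl , la , eq) (X.cursor u [] ∷ W.cursor v p ∷ ts) q) (suc (length p)) []
           (conf (finish mode s fl la eq)
                 (X.cursor u [] ∷ tape (blank ∷ ⌜ V ⌝ ++ blank ∷ baseW) blank [] ∷ ts) q′)
      copy-unless {q′ = q′} true v [] q refl e =
        still refl refl refl (subst (λ q → Re (conf _ _ q) 0 [] (conf _ _ q′)) (trans (sym e) (List.++-identityʳ q)) arrived)
      copy-unless {q′ = q′} false v [] q refl e =
        still refl refl refl (subst (λ q → Re (conf _ _ q) 0 [] (conf _ _ q′)) (trans (sym e) (List.++-identityʳ q)) arrived)
      copy-unless true  v (b ∷ p) q e e′ = still refl refl (W.cursor-right v b p) (copy-unless true (b ∷ v) p q e e′)
      copy-unless false v (b ∷ p) q e e′ =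
        emit refl refl (W.cursor-right v b p)
          (copy-unless false (b ∷ v) p (q ++ b ∷ []) e (trans (List.++-assoc q (b ∷ []) p) e′))

      handle-query : ∀ {eq} w q →
        Re (conf (comparing , s , fl , la , eq) (X.leftOf (reverse x) [] ∷ W.leftOf (reverse w) [] ∷ ts) q)
           (length x * 2 + length w * 2 + 4) []
           (conf (finish mode s fl la (does (w ≟ʷ x)))
                 (X.cursor (reverse x) [] ∷ tape (blank ∷ ⌜ reverse w ⌝ ++ blank ∷ baseW) blank [] ∷ ts)
                 (q ++ (if does (w ≟ʷ x) then [] else w)))
      handle-query {eq} w q with compare-words {eq} {q} (reverse x) (reverse w) [] []
      ... | u′ , v′ , r′ , p′ , run , e , e′ = relax bound
            (run ▷ return u′ r′ e
                 ▷ rewind v′ p′ w≡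
                 ▷ copy-checked (reverse-≟ w x))
        where
        copy-checked : ∀ {eq} → eq ≡ does (w ≟ʷ x) →
          Re (conf (copying , s , fl , la , eq) (X.cursor (reverse x) [] ∷ W.cursor [] w ∷ ts) q) (suc (length w)) []
             (conf (finish mode s fl la (does (w ≟ʷ x)))
                   (X.cursor (reverse x) [] ∷ tape (blank ∷ ⌜ reverse w ⌝ ++ blank ∷ baseW) blank [] ∷ ts)
                   (q ++ (if does (w ≟ʷ x) then [] else w)))
        copy-checked refl = copy-unless (does (w ≟ʷ x)) [] w q refl refl
        w≡ : v′ ʳ++ p′ ≡ w
        w≡ = begin
          v′ ʳ++ p′              ≡⟨ cong (v′ ʳ++_) (List.++-identityʳ p′) ⟨
          v′ ʳ++ (p′ ++ [])      ≡⟨ List.ʳ++-ʳ++ p′ ⟨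
          reverse (p′ ʳ++ v′)    ≡⟨ cong reverse e′ ⟩
          reverse (reverse w)    ≡⟨ List.reverse-involutive w ⟩
          w                      ∎
          where open ≡-Reasoning
        r′≤ : length r′ ≤ length x
        r′≤ = ≤-slack (length u′) (trans (sym (List.length-ʳ++ r′)) (trans (cong length e) (List.length-reverse x)))
        v′≤ : length v′ ≤ length w
        v′≤ = ≤-slack (length p′) (trans (sym (List.length-ʳ++ v′)) (cong length w≡))
        bound : suc (length (reverse x)) + (suc (length r′) + (suc (length v′) + suc (length w))) ≤ length x * 2 + length w * 2 + 4
        bound = begin
          suc (length (reverse x)) + (suc (length r′) + (suc (length v′) + suc (length w)))
            ≤⟨ +-mono-≤ (s≤s (≤-reflexive (List.length-reverse x))) (+-mono-≤ (s≤s r′≤) (+-monoˡ-≤ (suc (length w)) (s≤s v′≤))) ⟩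
          suc (length x) + (suc (length x) + (suc (length w) + suc (length w)))
            ≡⟨ arith (length x) (length w) ⟩
          length x * 2 + length w * 2 + 4 ∎
          where
          open ≤-Reasoning
          arith : ∀ a b → suc a + (suc a + (suc b + suc b)) ≡ a * 2 + b * 2 + 4
          arith = solve-∀

  -- With constant answers the copied words pile up on the real query tape and are never asked, so
  -- its content is arbitrary. When queries are forwarded, it must be empty before each of them.
  Fits : Mode → Word → Set
  Fits (just a) q = ⊤
  Fits nothing  q = q ≡ []

  module _ (B : Language) (x : Word) (baseX : List (Symbol m)) where

    private
      module X = Cursor {m = m} bit baseX

    Simulated : Mode → Fin Q → Bool → Bool → Vec (Tape m) k → List (Symbol m) → Word → ℕ → List Word → Bool → Set
    Simulated mode s fl la ts before q t qs b = ∀ {eq} →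
      Halts (kind mode) B (conf (running , s , fl , la , eq) (X.cursor (reverse x) [] ∷ tape before blank [] ∷ ts) q)
            t (forwarded mode x qs) (verdict mode (flagged x fl qs) (lastAnswer mode B x la qs) b)

    recast : ∀ {mode s X W W′ ts q q′ t qs b} → W ≡ W′ → q ≡ q′ →
      Halts (kind mode) B (conf s (X ∷ W′ ∷ ts) q′) t qs b → Halts (kind mode) B (conf s (X ∷ W ∷ ts) q) t qs b
    recast refl refl h = h

    after-query : ∀ mode {s fl la ts before q w t qs b} → Fits mode q →
      (∀ {fl la q} → Fits mode q → Simulated mode (resume s (answer mode B x w)) fl la ts before q t qs b) →
      Halts (kind mode) B
            (conf (finish mode s fl la (does (w ≟ʷ x))) (X.cursor (reverse x) [] ∷ tape before blank [] ∷ ts)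
                  (q ++ (if does (w ≟ʷ x) then [] else w)))
            (suc t) (forwarded mode x (w ∷ qs)) (verdict mode (flagged x fl (w ∷ qs)) (lastAnswer mode B x la (w ∷ qs)) b)
    after-query (just a) {w = w} fits sim with does (w ≟ʷ x)
    ... | true  = relaxʰ (n≤1+n _) (sim tt)
    ... | false = relaxʰ (n≤1+n _) (sim tt)
    after-query nothing {w = w} refl sim with does (w ≟ʷ x)
    ... | true  = relaxʰ (n≤1+n _) (sim refl)
    ... | false = let d , r , e = sim refl in d , query refl r , e

    -- A step adds at most one bit to the pending query and a query empties it, so `length w + t`
    -- never grows and N bounds all queries. A query costs two sweeps over x and two over the query
    -- word with 4 turns, one step to enter the comparison and one to ask: hence the 6.
    simulate : ∀ mode {s ts w t qs b fl la base v q} N → Run M (answer mode B x) (config s ts w) t qs b →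
      Fits mode q → v ≡ reverse w → length w + t ≤ N →
      Simulated mode s fl la ts (⌜ v ⌝ ++ blank ∷ base) q (t * (length x * 2 + N * 2 + 6)) qs b
    simulate mode {s} N (halted e) fits v≡ le {e₀} with OracleTM.kind M s in eq
    simulate mode {s} N (halted refl) fits v≡ le {e₀} | halting b =
      _ , arrived , cong (λ K → perform (runKind mode K s _ _ e₀) _ _) eq
    simulate mode {s} N (stepped e r) fits v≡ le {e₀} with OracleTM.kind M s in eq
    simulate mode {s} {ts} {w} {suc t} {b = b} {fl = fl} {la} {base} {v} {q} N (stepped refl r) fits refl le {e₀} | ordinary f =
      relaxʰ (+-monoˡ-≤ (t * (length x * 2 + N * 2 + 6)) (≤-trans (s≤s z≤n) (m≤n+m 6 (length x * 2 + N * 2))))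
        (move (cong (λ K → perform (runKind mode K s fl la e₀) _ q) eq) (arrived {t = 0})
         ▷ʰ recast (recorded out) (List.++-identityʳ q)
              (simulate mode {v = fromMaybe out ++ v} N r fits (reversed out) (bounded out)))
      where
      out : Maybe Bool
      out = proj₂ (proj₂ (f (Vec.map scanned ts)))
      recorded : ∀ out → writeMove (record-output blank out) (tape (⌜ v ⌝ ++ blank ∷ base) blank []) ≡
                         tape (⌜ fromMaybe out ++ v ⌝ ++ blank ∷ base) blank []
      recorded nothing  = refl
      recorded (just c) = refl
      reversed : ∀ out → fromMaybe out ++ reverse w ≡ reverse (w ++ fromMaybe out)
      reversed nothing  = cong reverse (sym (List.++-identityʳ w))
      reversed (just c) = sym (List.reverse-++ w (c ∷ []))
      bounded : ∀ out → length (w ++ fromMaybe out) + t ≤ N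
      bounded nothing  = ≤-trans (≤-trans (+-monoˡ-≤ t (≤-reflexive (cong length (List.++-identityʳ w)))) (+-monoʳ-≤ (length w) (n≤1+n t))) le
      bounded (just c) = ≤-trans (≤-reflexive (trans (cong (_+ t) (List.length-++ w)) (+-assoc (length w) 1 t))) le
    simulate mode {s} N (asked {κ = κ} e r) fits v≡ le {e₀} with OracleTM.kind M s in eq
    simulate mode {s} {ts} {w} {suc t} {w ∷ qs} {b} {fl} {la} {base} {v} {q} N (asked {κ = κ} refl r) fits refl le {e₀} | querying y n =
      relaxʰ bound
        (still mode B x baseX (cong (λ K → perform (runKind mode K s fl la e₀) _ q) eq)
           (X.cursor-left (reverse x) []) (Cursor.cursor-left bit base (reverse w) []) (arrived {t = 0})
         ▷ʰ handle-query mode B x baseX s fl la ts base w q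
         ▷ʰ after-query mode {w = w} fits λ fits →
              simulate mode {v = []} N (resumed (answer mode B x w) {κ} refl refl r) fits refl
                (≤-trans (n≤1+n t) (≤-trans (m≤n+m (suc t) (length w)) le)))
      where
      resumed : ∀ a {κ} → κ true ≡ config y ts [] → κ false ≡ config n ts [] →
        Run M (answer mode B x) (κ a) t qs b → Run M (answer mode B x) (config (resume s a) ts []) t qs b
      resumed true  e _ = subst (λ c → Run M _ c _ _ _) (trans e (cong (λ K → config (select K s true) ts []) (sym eq)))
      resumed false _ e = subst (λ c → Run M _ c _ _ _) (trans e (cong (λ K → config (select K s false) ts []) (sym eq)))
      L = length x * 2 + N * 2 + 6
      bound : 1 + (length x * 2 + length w * 2 + 4 + suc (t * L)) ≤ suc t * L
      bound = begin
        1 + (length x * 2 + length w * 2 + 4 + suc (t * L)) ≡⟨ arith (length x) (length w) (t * L) ⟩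
        length x * 2 + length w * 2 + 6 + t * L
          ≤⟨ +-monoˡ-≤ (t * L) (+-monoˡ-≤ 6 (+-monoʳ-≤ (length x * 2) (*-monoˡ-≤ 2 (≤-trans (m≤m+n (length w) (suc t)) le)))) ⟩
        length x * 2 + N * 2 + 6 + t * L ∎
        where
        open ≤-Reasoning
        arith : ∀ a b c → 1 + (a * 2 + b * 2 + 4 + suc c) ≡ a * 2 + b * 2 + 6 + c
        arith = solve-∀

-- Queue machines

-- A tape is stored from left to right with the scanned cell marked `head`, and closed by `gap`. The
-- final `end a` carries the assumed answer a, which selects the transition table and so need not be
-- part of the phase.
data Glyph (m : ℕ) : Set where
  input    : Bool → Glyph m
  inputEnd : Glyph m
  cell     : Symbol m → Glyph m
  head     : Symbol m → Glyph m
  gap      : Glyph m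
  end      : Bool → Glyph m

-- The input glyphs come first, with numbers 0, 1, 2 for every m. The universal machine can
-- therefore write their codes without knowing the program.
finite-Glyph : ∀ m → Finite (Glyph m)
finite-Glyph m = retract
  (λ { (input false) → inj₁ (Fin.# 0) ; (input true) → inj₁ (Fin.# 1) ; inputEnd → inj₁ (Fin.# 2)
     ; (cell s) → inj₂ (inj₁ s) ; (head s) → inj₂ (inj₂ (inj₁ s))
     ; gap → inj₂ (inj₂ (inj₂ (inj₁ tt))) ; (end a) → inj₂ (inj₂ (inj₂ (inj₂ a))) })
  (λ { (inj₁ zero) → input false ; (inj₁ (suc zero)) → input true ; (inj₁ (suc (suc zero))) → inputEnd
     ; (inj₂ (inj₁ s)) → cell s ; (inj₂ (inj₂ (inj₁ s))) → head s
     ; (inj₂ (inj₂ (inj₂ (inj₁ tt)))) → gap ; (inj₂ (inj₂ (inj₂ (inj₂ a)))) → end a })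
  (λ { (input false) → refl ; (input true) → refl ; inputEnd → refl
     ; (cell s) → refl ; (head s) → refl ; gap → refl ; (end a) → refl })
  (finite-Fin 3 finite-⊎ finite-Symbol m finite-⊎ finite-Symbol m finite-⊎ finite-⊤ finite-⊎ finite-Bool)

-- A shift register, which spares a phase the index of the current tape: collected symbols enter at
-- the back until the initial content is gone, and actions rotate so that the first one belongs to
-- the current tape.
shift : ∀ {A : Set} {n} → Vec A (suc n) → A → Vec A (suc n)
shift (_ ∷ v) a = v Vec.∷ʳ a

shifts : ∀ {A : Set} {n j} → Vec A (suc n) → Vec A j → Vec A (suc n)
shifts v []      = v
shifts v (a ∷ w) = shifts (shift v a) w

toList-shifts : ∀ {A : Set} {n j} (v : Vec A (suc n)) (u w : Vec A j) {r} →
  Vec.toList v ≡ Vec.toList u ++ r → Vec.toList (shifts v w) ≡ r ++ Vec.toList w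
toList-shifts v       []      []      {r} e = trans e (sym (List.++-identityʳ r))
toList-shifts (_ ∷ v) (_ ∷ u) (a ∷ w) {r} e =
  trans (toList-shifts (v Vec.∷ʳ a) u w (trans (Vec.toList-∷ʳ a v) (trans (cong (_++ a ∷ []) (List.∷-injectiveʳ e)) (List.++-assoc (Vec.toList u) r (a ∷ [])))))
        (List.++-assoc r (a ∷ []) (Vec.toList w))

shifts-full : ∀ {A : Set} {n} (v w : Vec A (suc n)) → shifts v w ≡ w
shifts-full v w = trans (sym (Vec.cast-is-id refl _)) (Vec.toList-injective refl _ _ (toList-shifts v v w (sym (List.++-identityʳ (Vec.toList v)))))

-- A move to the left changes the cell before the `head` glyph, so output lags one cell behind, with
-- that cell `held`. After a move to the right the head is `due` at the next cell, or at a new blank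
-- if the tape ends there.
data Local (m : ℕ) : Set where
  fresh due copy : Local m
  held           : Symbol m → Local m

finite-Local : ∀ m → Finite (Local m)
finite-Local m = retract
  (λ { fresh → inj₁ (Fin.# 0) ; due → inj₁ (Fin.# 1) ; copy → inj₁ (Fin.# 2) ; (held s) → inj₂ s })
  (λ { (inj₁ zero) → fresh ; (inj₁ (suc zero)) → due ; (inj₁ (suc (suc zero))) → copy ; (inj₂ s) → held s })
  (λ { fresh → refl ; due → refl ; copy → refl ; (held s) → refl })
  (finite-Fin 3 finite-⊎ finite-Symbol m)

data Phase (k m : ℕ) (S : Set) : Set where
  readX₀ readX readZ₀ readZ readReply : Phase k m S
  collect : S → Vec (Symbol m) k → Phase k m S
  update  : S → Vec (Symbol m × Direction) k → Local m → Phase k m S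

-- The initial phase `readX₀` receives number 0, which lets the row counter start at 0 for every
-- program.
finite-Phase : ∀ {S} k m → Finite S → Finite (Phase k m S)
finite-Phase k m F = retract
  (λ { readX₀ → inj₁ (Fin.# 0) ; readX → inj₁ (Fin.# 1) ; readZ₀ → inj₁ (Fin.# 2) ; readZ → inj₁ (Fin.# 3)
     ; readReply → inj₁ (Fin.# 4) ; (collect s v) → inj₂ (inj₁ (s , v)) ; (update s v l) → inj₂ (inj₂ (s , v , l)) })
  (λ { (inj₁ zero) → readX₀ ; (inj₁ (suc zero)) → readX ; (inj₁ (suc (suc zero))) → readZ₀
     ; (inj₁ (suc (suc (suc zero)))) → readZ ; (inj₁ (suc (suc (suc (suc zero))))) → readReply
     ; (inj₂ (inj₁ (s , v))) → collect s v ; (inj₂ (inj₂ (s , v , l))) → update s v l })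
  (λ { readX₀ → refl ; readX → refl ; readZ₀ → refl ; readZ → refl ; readReply → refl
     ; (collect s v) → refl ; (update s v l) → refl })
  (finite-Fin 5 finite-⊎ (F finite-× finite-Vec (finite-Symbol m) k)
   finite-⊎ (F finite-× finite-Vec (finite-Symbol m finite-× finite-Direction) k finite-× finite-Local m))

module QueueMachine {P Γ : Set} (δ : P → Γ → (P × List Γ) ⊎ Bool) where

  data QHalts : P → List Γ → ℕ → Bool → Set where
    qstop : ∀ {p γ q n b} → δ p γ ≡ inj₂ b → QHalts p (γ ∷ q) (suc n) b
    qstep : ∀ {p γ q p′ w n b} → δ p γ ≡ inj₁ (p′ , w) → QHalts p′ (q ++ w) n b → QHalts p (γ ∷ q) (suc n) b

  data Pass : P → List Γ → List Γ → P → Set where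
    []  : ∀ {p} → Pass p [] [] p
    _∷_ : ∀ {p γ l o p′ w p″} → δ p γ ≡ inj₁ (p′ , w) → Pass p′ l o p″ → Pass p (γ ∷ l) (w ++ o) p″

  infixr 5 _⊙_
  _⊙_ : ∀ {p p′ p″ l l′ o o′} → Pass p l o p′ → Pass p′ l′ o′ p″ → Pass p (l ++ l′) (o ++ o′) p″
  []                    ⊙ P′ = P′
  _∷_ {o = o} {w = w} e P ⊙ P′ = subst (λ o → Pass _ _ o _) (sym (List.++-assoc w o _)) (e ∷ (P ⊙ P′))

  recastᵖ : ∀ {p p′ l l′ o o′} → l ≡ l′ → o ≡ o′ → Pass p l o p′ → Pass p l′ o′ p′
  recastᵖ refl refl P = P

  run-pass : ∀ {p p′ l o n b} r → Pass p l o p′ → QHalts p′ (r ++ o) n b → QHalts p (l ++ r) (length l + n) b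
  run-pass r [] h = subst (λ q → QHalts _ q _ _) (List.++-identityʳ r) h
  run-pass r (_∷_ {l = l} {o = o} {w = w} e P) h =
    qstep e (subst (λ q → QHalts _ q _ _) (sym (List.++-assoc l r w))
              (run-pass (r ++ w) P (subst (λ q → QHalts _ q _ _) (sym (List.++-assoc r w o)) h)))

  run-full-pass : ∀ {p p′ l o n b} → Pass p l o p′ → QHalts p′ o n b → QHalts p l (length l + n) b
  run-full-pass {p} {l = l} {n = n} {b} P h = subst (λ q → QHalts p q (length l + n) b) (List.++-identityʳ l) (run-pass [] P h)

  relax-q : ∀ {p q n n′ b} → n ≤ n′ → QHalts p q n b → QHalts p q n′ b
  relax-q (s≤s le) (qstop e)   = qstop e
  relax-q (s≤s le) (qstep e h) = qstep e (relax-q le h)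

-- The queue machine keeps the tapes of δ a on its queue, a word per tape. Each
-- step of δ a takes a pass that collects the scanned symbols and one that updates them.
module TapeQueue {e m : ℕ} {S : Set} (s₀ : S) (T : Bool → S → Kind (3 + e) m S) where

  private
    k : ℕ
    k = 3 + e

  blanks : Vec (Symbol m) k
  blanks = Vec.replicate k blank

  blankTapes : ℕ → List (Glyph m)
  blankTapes zero    = []
  blankTapes (suc j) = head blank ∷ gap ∷ blankTapes j

  Next : Set
  Next = (Phase k m S × List (Glyph m)) ⊎ Bool

  begin-step : Bool → Kind k m S → Vec (Symbol m) k → Next
  begin-step a (halting b)  v = inj₂ b
  -- Not met in the simulated runs, whose query list is empty.
  begin-step a (querying _) v = inj₂ false
  begin-step a (ordinary f) v = let s , acts , _ = f v in inj₁ (update s acts fresh , end a ∷ [])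

  place : S → Vec (Symbol m × Direction) k → Direction → Symbol m → Maybe (Symbol m) → Next
  place s acts stay  w nothing  = inj₁ (update s acts copy , head w ∷ [])
  place s acts left  w nothing  = inj₁ (update s acts copy , head blank ∷ cell w ∷ [])
  place s acts right w nothing  = inj₁ (update s acts due , cell w ∷ [])
  place s acts stay  w (just c) = inj₁ (update s acts copy , cell c ∷ head w ∷ [])
  place s acts left  w (just c) = inj₁ (update s acts copy , head c ∷ cell w ∷ [])
  place s acts right w (just c) = inj₁ (update s acts due , cell c ∷ cell w ∷ [])

  rotate : Vec (Symbol m × Direction) k → Vec (Symbol m × Direction) k
  rotate acts = shift acts (Vec.head acts)

  δ : Phase k m S → Glyph m → Next
  δ readX₀ (input b)    = inj₁ (readX , cell blank ∷ cell (bit b) ∷ [])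
  δ readX₀ inputEnd     = inj₁ (readZ₀ , cell blank ∷ head blank ∷ gap ∷ cell blank ∷ head blank ∷ gap ∷ [])
  δ readX (input b)     = inj₁ (readX , cell (bit b) ∷ [])
  δ readX inputEnd      = inj₁ (readZ₀ , head blank ∷ gap ∷ cell blank ∷ head blank ∷ gap ∷ [])
  -- No rule for `inputEnd`: the word read here starts with a description and is nonempty.
  δ readZ₀ (input b)    = inj₁ (readZ , head (bit b) ∷ [])
  δ readZ (input b)     = inj₁ (readZ , cell (bit b) ∷ [])
  δ readZ inputEnd      = inj₁ (readReply , gap ∷ blankTapes e)
  δ readReply (input a) = inj₁ (collect s₀ blanks , end a ∷ [])
  δ (collect s v) (cell c) = inj₁ (collect s v , cell c ∷ [])
  δ (collect s v) (head c) = inj₁ (collect s (shift v c) , head c ∷ [])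
  δ (collect s v) gap      = inj₁ (collect s v , gap ∷ [])
  δ (collect s v) (end a)  = begin-step a (T a s) v
  δ (update s acts fresh) (cell c)    = inj₁ (update s acts (held c) , [])
  δ (update s acts fresh) (head _)    = let w , d = Vec.head acts in place s acts d w nothing
  δ (update s acts fresh) (end a)     = inj₁ (collect s blanks , end a ∷ [])
  δ (update s acts (held b)) (cell c) = inj₁ (update s acts (held c) , cell b ∷ [])
  δ (update s acts (held b)) (head _) = let w , d = Vec.head acts in place s acts d w (just b)
  δ (update s acts due) (cell c)      = inj₁ (update s acts copy , head c ∷ [])
  δ (update s acts due) gap           = inj₁ (update s (rotate acts) fresh , head blank ∷ gap ∷ [])
  δ (update s acts copy) (cell c)     = inj₁ (update s acts copy , cell c ∷ [])
  δ (update s acts copy) gap          = inj₁ (update s (rotate acts) fresh , gap ∷ [])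
  δ _ _ = inj₂ false

  open QueueMachine δ public

  glyphs : Tape m → List (Glyph m)
  glyphs t = List.map cell (reverse (before t)) ++ head (scanned t) ∷ List.map cell (after t) ++ gap ∷ []

  allGlyphs : ∀ {j} → Vec (Tape m) j → List (Glyph m)
  allGlyphs []       = []
  allGlyphs (t ∷ ts) = glyphs t ++ allGlyphs ts

  collect-cells : ∀ {s v} l → Pass (collect s v) (List.map cell l) (List.map cell l) (collect s v)
  collect-cells []      = []
  collect-cells (c ∷ l) = refl ∷ collect-cells l

  collect-tape : ∀ {s v} t → Pass (collect s v) (glyphs t) (glyphs t) (collect s (shift v (scanned t)))
  collect-tape t = collect-cells (reverse (before t)) ⊙ (refl ∷ (collect-cells (after t) ⊙ (refl ∷ [])))

  collect-tapes : ∀ {s v j} (ts : Vec (Tape m) j) →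
    Pass (collect s v) (allGlyphs ts) (allGlyphs ts) (collect s (shifts v (Vec.map scanned ts)))
  collect-tapes []       = []
  collect-tapes (t ∷ ts) = collect-tape t ⊙ collect-tapes ts

  copy-rest : ∀ {s acts} l →
    Pass (update s acts copy) (List.map cell l ++ gap ∷ []) (List.map cell l ++ gap ∷ []) (update s (rotate acts) fresh)
  copy-rest []      = refl ∷ []
  copy-rest (c ∷ l) = refl ∷ copy-rest l

  hold-more : ∀ {s acts} b l c →
    Pass (update s acts (held b)) (List.map cell (l ++ c ∷ [])) (List.map cell (b ∷ l)) (update s acts (held c))
  hold-more b []      c = refl ∷ []
  hold-more b (x ∷ l) c = refl ∷ hold-more x l c

  hold : ∀ {s acts} l c →
    Pass (update s acts fresh) (List.map cell (l ++ c ∷ [])) (List.map cell l) (update s acts (held c))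
  hold []      c = refl ∷ []
  hold (x ∷ l) c = refl ∷ hold-more x l c

  dueGlyphs : List (Symbol m) → List (Glyph m)
  dueGlyphs []      = head blank ∷ gap ∷ []
  dueGlyphs (c ∷ l) = head c ∷ List.map cell l ++ gap ∷ []

  place-due : ∀ {s acts} l →
    Pass (update s acts due) (List.map cell l ++ gap ∷ []) (dueGlyphs l) (update s (rotate acts) fresh)
  place-due []      = refl ∷ []
  place-due (c ∷ l) = refl ∷ copy-rest l

  cells-snoc : ∀ (c : Symbol m) l r → List.map cell (reverse (c ∷ l)) ++ r ≡ List.map cell (reverse l) ++ cell c ∷ r
  cells-snoc c l r = begin
    List.map cell (reverse (c ∷ l)) ++ r        ≡⟨ cong (λ l → List.map cell l ++ r) (List.unfold-reverse c l) ⟩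
    List.map cell (reverse l ++ c ∷ []) ++ r    ≡⟨ cong (_++ r) (List.map-++ cell (reverse l) (c ∷ [])) ⟩
    (List.map cell (reverse l) ++ cell c ∷ []) ++ r ≡⟨ List.++-assoc (List.map cell (reverse l)) (cell c ∷ []) r ⟩
    List.map cell (reverse l) ++ cell c ∷ r     ∎
    where open ≡-Reasoning

  glyphs-right : ∀ u (w : Symbol m) l → List.map cell (reverse (w ∷ u)) ++ dueGlyphs l ≡ glyphs (moveHead right (tape u w l))
  glyphs-right u w []      = refl
  glyphs-right u w (_ ∷ _) = refl

  update-tape : ∀ {s} acts t →
    Pass (update s acts fresh) (glyphs t) (glyphs (writeMove (Vec.head acts) t)) (update s (rotate acts) fresh)
  update-tape ((w , stay) ∷ acts) (tape [] h l) = refl ∷ copy-rest l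
  update-tape ((w , left) ∷ acts) (tape [] h l) = refl ∷ copy-rest l
  update-tape ((w , right) ∷ acts) (tape [] h l) = recastᵖ refl (glyphs-right [] w l) (refl ∷ place-due l)
  update-tape ((w , stay) ∷ acts) (tape (c ∷ u) h l) =
    recastᵖ (cong (λ u → List.map cell u ++ _) (sym (List.unfold-reverse c u))) (sym (cells-snoc c u _))
      (hold (reverse u) c ⊙ (refl ∷ copy-rest l))
  update-tape ((w , left) ∷ acts) (tape (c ∷ u) h l) =
    recastᵖ (cong (λ u → List.map cell u ++ _) (sym (List.unfold-reverse c u))) refl
      (hold (reverse u) c ⊙ (refl ∷ copy-rest l))
  update-tape ((w , right) ∷ acts) (tape (c ∷ u) h l) =
    recastᵖ (cong (λ u → List.map cell u ++ _) (sym (List.unfold-reverse c u)))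
      (trans (sym (cells-snoc c u _)) (trans (sym (cells-snoc w (c ∷ u) _)) (glyphs-right (c ∷ u) w l)))
      (hold (reverse u) c ⊙ (refl ∷ place-due l))

  -- The register begins with the actions for the tapes still to come; `r` collects those that have
  -- rotated to the back.
  update-tapes : ∀ {s j} acts (as : Vec (Symbol m × Direction) j) ts {r} → Vec.toList acts ≡ Vec.toList as ++ r →
    ∃[ acts′ ] Pass (update s acts fresh) (allGlyphs ts) (allGlyphs (Vec.zipWith writeMove as ts)) (update s acts′ fresh)
  update-tapes acts [] [] e = acts , []
  update-tapes (a ∷ acts) (_ ∷ as) (t ∷ ts) {r} e with refl ← List.∷-injectiveˡ e =
    let acts′ , P = update-tapes (acts Vec.∷ʳ a) as ts
                      (trans (Vec.toList-∷ʳ a acts) (trans (cong (_++ a ∷ []) (List.∷-injectiveʳ e)) (List.++-assoc (Vec.toList as) r (a ∷ []))))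
    in acts′ , update-tape (a ∷ acts) t ⊙ P

  queue : Bool → Vec (Tape m) k → List (Glyph m)
  queue a ts = allGlyphs ts ++ end a ∷ []

  length-glyphs : ∀ t → length (glyphs t) ≡ length (before t) + (2 + length (after t))
  length-glyphs t = trans (List.length-++ (List.map cell (reverse (before t))))
    (cong₂ _+_ (trans (List.length-map cell (reverse (before t))) (List.length-reverse (before t)))
      (cong suc (trans (List.length-++ (List.map cell (after t))) (trans (+-comm _ 1) (cong suc (List.length-map cell (after t)))))))

  glyphs-growth : ∀ a t → length (glyphs (writeMove a t)) ≤ suc (length (glyphs t))
  glyphs-growth (w , d) t = begin
    length (glyphs (writeMove (w , d) t))                 ≡⟨ length-glyphs (writeMove (w , d) t) ⟩
    length (before (writeMove (w , d) t)) + (2 + length (after (writeMove (w , d) t))) ≤⟨ moved d t ⟩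
    suc (length (before t) + (2 + length (after t)))      ≡⟨ cong suc (length-glyphs t) ⟨
    suc (length (glyphs t))                               ∎
    where
    open ≤-Reasoning
    moved : ∀ d t → length (before (writeMove (w , d) t)) + (2 + length (after (writeMove (w , d) t))) ≤
                    suc (length (before t) + (2 + length (after t)))
    moved stay  t                  = n≤1+n _
    moved left  (tape [] s r)      = ≤-refl
    moved left  (tape (c ∷ l) s r) = ≤-trans (≤-reflexive (+-suc (length l) (2 + length r))) (n≤1+n _)
    moved right (tape l s [])      = ≤-refl
    moved right (tape l s (c ∷ r)) = s≤s (+-monoʳ-≤ (length l) (n≤1+n _))

  allGlyphs-growth : ∀ {j} as (ts : Vec (Tape m) j) →
    length (allGlyphs (Vec.zipWith writeMove as ts)) ≤ j + length (allGlyphs ts)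
  allGlyphs-growth [] [] = z≤n
  allGlyphs-growth {suc j} (a ∷ as) (t ∷ ts) = begin
    length (glyphs (writeMove a t) ++ allGlyphs (Vec.zipWith writeMove as ts))
      ≡⟨ List.length-++ (glyphs (writeMove a t)) ⟩
    length (glyphs (writeMove a t)) + length (allGlyphs (Vec.zipWith writeMove as ts))
      ≤⟨ +-mono-≤ (glyphs-growth a t) (allGlyphs-growth as ts) ⟩
    suc (length (glyphs t)) + (j + length (allGlyphs ts))
      ≡⟨ arith (length (glyphs t)) j (length (allGlyphs ts)) ⟩
    suc j + (length (glyphs t) + length (allGlyphs ts))
      ≡⟨ cong (suc j +_) (List.length-++ (glyphs t)) ⟨
    suc j + length (allGlyphs (t ∷ ts)) ∎
    where
    open ≤-Reasoning
    arith : ∀ x y z → suc x + (y + z) ≡ suc y + (x + z)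
    arith = solve-∀

  collect-pass : ∀ {s a p w} ts → begin-step a (T a s) (Vec.map scanned ts) ≡ inj₁ (p , w) →
    Pass (collect s blanks) (queue a ts) (allGlyphs ts ++ w ++ []) p
  collect-pass {s} {a} ts e =
    collect-tapes ts ⊙ (trans (cong (begin-step a (T a s)) (shifts-full blanks (Vec.map scanned ts))) e ∷ [])

  update-pass : ∀ {s a} acts ts →
    Pass (update s acts fresh) (queue a ts) (queue a (Vec.zipWith writeMove acts ts)) (collect s blanks)
  update-pass acts ts =
    let _ , P = update-tapes acts acts ts (sym (List.++-identityʳ (Vec.toList acts)))
    in P ⊙ (refl ∷ [])

  -- Each step stores at most one more cell on each of the k tapes, so the queue stays within Z, and
  -- the two passes of a step cost at most `Z * 2`. The extra unit in `suc t` pays for the last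
  -- collecting pass, which ends in the verdict.
  simulate-queue : ∀ {B a s ts w t b} Z → Halts (T a) B (conf s ts w) t [] b →
    length (queue a ts) + t * k ≤ Z → QHalts (collect s blanks) (queue a ts) (suc t * (Z * 2)) b
  simulate-queue {a = a} {s} {ts} Z (_ , arrived , e) le with T a s in eq
  simulate-queue {a = a} {s} {ts} {t = t} {b} Z (_ , arrived , refl) le | halting .b =
    relax-q (≤-trans (≤-reflexive (sym (List.length-++ (allGlyphs ts)))) (≤-trans (m+n≤o⇒m≤o _ le)
              (≤-trans (m≤m*n Z 2) (m≤m+n (Z * 2) (t * (Z * 2))))))
      (run-pass (end a ∷ []) (collect-tapes ts) (qstop {n = 0}
        (trans (cong (begin-step a (T a s)) (shifts-full blanks (Vec.map scanned ts))) (cong (λ K → begin-step a K (Vec.map scanned ts)) eq))))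
  simulate-queue {a = a} {s} {ts} Z (d , move e r , e′) le with T a s in eq
  simulate-queue {a = a} {s} {ts} {t = suc t} Z (d , move refl r , e′) le | ordinary f =
    relax-q bound (run-full-pass (collect-pass ts (cong (λ K → begin-step a K (Vec.map scanned ts)) eq))
      (run-full-pass (update-pass acts ts) (simulate-queue Z (d , r , e′) smaller)))
    where
    acts : Vec (Symbol m × Direction) k
    acts = proj₁ (proj₂ (f (Vec.map scanned ts)))
    smaller : length (queue a (Vec.zipWith writeMove acts ts)) + t * k ≤ Z
    smaller = ≤-trans (≤-reflexive (cong (_+ t * k) (List.length-++ (allGlyphs (Vec.zipWith writeMove acts ts)))))
      (≤-trans (+-monoˡ-≤ (t * k) (+-monoˡ-≤ 1 (allGlyphs-growth acts ts)))
      (≤-trans (≤-reflexive (trans (arith (length (allGlyphs ts)) k (t * k)) (cong (_+ (k + t * k)) (sym (List.length-++ (allGlyphs ts)))))) le))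
      where
      arith : ∀ x y z → y + x + 1 + z ≡ x + 1 + (y + z)
      arith = solve-∀
    bound : length (queue a ts) + (length (queue a ts) + suc t * (Z * 2)) ≤ suc (suc t) * (Z * 2)
    bound = ≤-trans (≤-reflexive (sym (+-assoc (length (queue a ts)) _ _)))
      (+-monoˡ-≤ (suc t * (Z * 2)) (≤-trans (+-mono-≤ G≤ G≤) (≤-reflexive (arith Z))))
      where
      G≤ : length (queue a ts) ≤ Z
      G≤ = m+n≤o⇒m≤o _ le
      arith : ∀ z → z + z ≡ z * 2
      arith = solve-∀

  inputs : Word → Word → Bool → List (Glyph m)
  inputs x z a = List.map input x ++ inputEnd ∷ List.map input z ++ inputEnd ∷ input a ∷ []

  -- The situation in which `Interception` starts: the head behind x, an empty delimited query tape,
  -- then the tapes of M. The reading phases produce it directly on the queue.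
  initialTapes : Word → Word → Vec (Tape m) k
  initialTapes x z = Cursor.cursor bit [] (reverse x) [] ∷ Cursor.cursor bit [] [] [] ∷ inputTape z ∷ Vec.replicate e blankTape

  separatorGlyphs : List (Glyph m)
  separatorGlyphs = head blank ∷ gap ∷ cell blank ∷ head blank ∷ gap ∷ []

  read-rest : ∀ x → Pass readX (List.map input x ++ inputEnd ∷ []) (List.map (cell ∘ bit) x ++ separatorGlyphs) readZ₀
  read-rest []      = refl ∷ []
  read-rest (b ∷ x) = refl ∷ read-rest x

  read-short : ∀ x → Pass readX₀ (List.map input x ++ inputEnd ∷ []) (cell blank ∷ List.map (cell ∘ bit) x ++ separatorGlyphs) readZ₀
  read-short []      = refl ∷ []
  read-short (b ∷ x) = refl ∷ read-rest x

  read-long-rest : ∀ z → Pass readZ (List.map input z ++ inputEnd ∷ []) (List.map (cell ∘ bit) z ++ gap ∷ blankTapes e) readReply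
  read-long-rest []      = recastᵖ refl (cong (gap ∷_) (List.++-identityʳ (blankTapes e))) (refl ∷ [])
  read-long-rest (b ∷ z) = refl ∷ read-long-rest z

  initial-pass : ∀ x b z a →
    Pass readX₀ (inputs x (b ∷ z) a) (queue a (initialTapes x (b ∷ z))) (collect s₀ blanks)
  initial-pass x b z a =
    recastᵖ unassoc loaded (read-short x ⊙ (refl ∷ (read-long-rest z ⊙ (refl ∷ []))))
    where
    unassoc : (List.map input x ++ inputEnd ∷ []) ++ input b ∷ (List.map input z ++ inputEnd ∷ []) ++ input a ∷ [] ≡ inputs x (b ∷ z) a
    unassoc = trans (List.++-assoc (List.map input x) (inputEnd ∷ []) _)
      (cong (λ l → List.map input x ++ inputEnd ∷ input b ∷ l) (List.++-assoc (List.map input z) (inputEnd ∷ []) (input a ∷ [])))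
    blank-glyphs : ∀ j → blankTapes j ≡ allGlyphs (Vec.replicate j blankTape)
    blank-glyphs zero    = refl
    blank-glyphs (suc j) = cong (λ l → head blank ∷ gap ∷ l) (blank-glyphs j)
    short-glyphs : List.map cell (reverse (⌜ reverse x ⌝ ++ blank ∷ [])) ≡ cell blank ∷ List.map (cell ∘ bit) x
    short-glyphs = begin
      List.map cell (reverse (⌜ reverse x ⌝ ++ blank ∷ []))
        ≡⟨ cong (List.map cell) (List.reverse-++ ⌜ reverse x ⌝ (blank ∷ [])) ⟩
      cell blank ∷ List.map cell (reverse ⌜ reverse x ⌝)
        ≡⟨ cong (λ l → cell blank ∷ List.map cell l) (List.reverse-map bit (reverse x)) ⟨
      cell blank ∷ List.map cell ⌜ reverse (reverse x) ⌝
        ≡⟨ cong (λ l → cell blank ∷ List.map cell ⌜ l ⌝) (List.reverse-involutive x) ⟩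
      cell blank ∷ List.map cell ⌜ x ⌝
        ≡⟨ cong (cell blank ∷_) (List.map-∘ x) ⟨
      cell blank ∷ List.map (cell ∘ bit) x ∎
      where open ≡-Reasoning
    arrange : ∀ A Z B E → (A ++ separatorGlyphs) ++ head (bit b) ∷ (Z ++ gap ∷ B) ++ E ≡
      ((A ++ head blank ∷ gap ∷ []) ++ cell blank ∷ head blank ∷ gap ∷ head (bit b) ∷ (Z ++ gap ∷ []) ++ B) ++ E
    arrange A Z B E = begin
      (A ++ separatorGlyphs) ++ head (bit b) ∷ (Z ++ gap ∷ B) ++ E
        ≡⟨ List.++-assoc A separatorGlyphs _ ⟩
      A ++ separatorGlyphs ++ head (bit b) ∷ (Z ++ gap ∷ B) ++ E
        ≡⟨ cong (λ l → A ++ separatorGlyphs ++ head (bit b) ∷ l ++ E) (List.++-assoc Z (gap ∷ []) B) ⟨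
      A ++ separatorGlyphs ++ head (bit b) ∷ ((Z ++ gap ∷ []) ++ B) ++ E
        ≡⟨ List.++-assoc A (head blank ∷ gap ∷ []) _ ⟨
      (A ++ head blank ∷ gap ∷ []) ++ cell blank ∷ head blank ∷ gap ∷ head (bit b) ∷ ((Z ++ gap ∷ []) ++ B) ++ E
        ≡⟨ List.++-assoc (A ++ head blank ∷ gap ∷ []) _ E ⟨
      ((A ++ head blank ∷ gap ∷ []) ++ cell blank ∷ head blank ∷ gap ∷ head (bit b) ∷ (Z ++ gap ∷ []) ++ B) ++ E ∎
      where open ≡-Reasoning
    loaded : (cell blank ∷ List.map (cell ∘ bit) x ++ separatorGlyphs) ++ head (bit b) ∷ (List.map (cell ∘ bit) z ++ gap ∷ blankTapes e) ++ end a ∷ []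
             ≡ queue a (initialTapes x (b ∷ z))
    loaded = trans (arrange (cell blank ∷ List.map (cell ∘ bit) x) (List.map (cell ∘ bit) z) (blankTapes e) (end a ∷ []))
      (cong₂ (λ X ZB → ((X ++ head blank ∷ gap ∷ []) ++ cell blank ∷ head blank ∷ gap ∷ head (bit b) ∷ ZB) ++ end a ∷ [])
        (sym short-glyphs) (cong₂ (λ Z B → (Z ++ gap ∷ []) ++ B) (List.map-∘ z) (blank-glyphs e)))

  length-inputs : ∀ x z a → length (inputs x z a) ≡ length x + length z + 3
  length-inputs x z a = trans (List.length-++ (List.map input x)) (trans
    (cong₂ (λ m n → m + suc n) (List.length-map input x)
      (trans (List.length-++ (List.map input z)) (cong (_+ 2) (List.length-map input z))))
    (arith (length x) (length z)))
    where
    arith : ∀ x z → x + suc (z + 2) ≡ x + z + 3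
    arith = solve-∀

  length-queue : ∀ x b z a → length (queue a (initialTapes x (b ∷ z))) ≡ length x + length z + (9 + e * 2)
  length-queue x b z a = begin
    length (queue a (initialTapes x (b ∷ z)))
      ≡⟨ List.length-++ (allGlyphs (initialTapes x (b ∷ z))) ⟩
    length (allGlyphs (initialTapes x (b ∷ z))) + 1
      ≡⟨ cong (_+ 1) (List.length-++ (glyphs X)) ⟩
    length (glyphs X) + (3 + length (glyphs (inputTape (b ∷ z)) ++ allGlyphs (Vec.replicate e blankTape))) + 1
      ≡⟨ cong₂ (λ i j → i + (3 + j) + 1) (length-glyphs X)
           (trans (List.length-++ (glyphs (inputTape (b ∷ z)))) (cong₂ _+_ (length-glyphs (inputTape (b ∷ z))) (blank-length e))) ⟩
    length (⌜ reverse x ⌝ ++ blank ∷ []) + 2 + (3 + (2 + length {A = Symbol m} ⌜ z ⌝ + e * 2)) + 1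
      ≡⟨ cong₂ (λ i j → i + 2 + (3 + (2 + j + e * 2)) + 1)
           (trans (List.length-++ ⌜ reverse x ⌝) (cong (_+ 1) (trans (List.length-map bit (reverse x)) (List.length-reverse x))))
           (List.length-map bit z) ⟩
    length x + 1 + 2 + (3 + (2 + length z + e * 2)) + 1
      ≡⟨ arith (length x) (length z) (e * 2) ⟩
    length x + length z + (9 + e * 2) ∎
    where
    open ≡-Reasoning
    X : Tape m
    X = Cursor.cursor bit [] (reverse x) []
    blank-length : ∀ j → length (allGlyphs (Vec.replicate j blankTape)) ≡ j * 2
    blank-length zero    = refl
    blank-length (suc j) = cong (2 +_) (blank-length j)
    arith : ∀ x z e → x + 1 + 2 + (3 + (2 + z + e)) + 1 ≡ x + z + (9 + e)
    arith = solve-∀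

-- The universal machine

-- Programs are rows of tokens, each ended by `row`: `push` appends to the queue, `inc`
-- adds to the number of the next row, `reply` halts.

data Token : Set where
  push  : Bool → Token
  inc   : Token
  row   : Token
  reply : Bool → Token

Program : Set
Program = List Token

pop : ℕ → List Bool → Maybe (ℕ × List Bool)
pop n []          = nothing
pop n (true ∷ q)  = pop (suc n) q
pop n (false ∷ q) = just (n , q)

skip skipRow : ℕ → Program → Maybe Program
skip zero    c = just c
skip (suc n) c = skipRow n c
skipRow n []              = nothing
skipRow n (row ∷ c)       = skip n c
skipRow n (push _ ∷ c)    = skipRow n c
skipRow n (inc ∷ c)       = skipRow n c
skipRow n (reply _ ∷ c)   = skipRow n c

exec : Program → List Bool → ℕ → Bool ⊎ (ℕ × List Bool)
exec []            q n = inj₁ false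
exec (push b ∷ c)  q n = exec c (q ++ b ∷ []) n
exec (inc ∷ c)     q n = exec c q (suc n)
exec (row ∷ c)     q n = inj₂ (n , q)
exec (reply b ∷ c) q n = inj₁ b

Round : Set
Round = Bool ⊎ (ℕ × List Bool)

runRow : Maybe Program → List Bool → Round
runRow nothing  q = inj₁ false
runRow (just c) q = exec c q 0

dispatch : Program → Maybe (ℕ × List Bool) → Round
dispatch p nothing        = inj₁ false
dispatch p (just (n , q)) = runRow (skip n p) q

-- A round pops 1ⁿ′0 off the queue and executes row n + n′; the number of `inc`s
-- met there is the n of the next round.
eval : Program → ℕ → ℕ → List Bool → Bool
continue : Program → ℕ → Round → Bool
eval p zero    n q = false
eval p (suc f) n q = continue p f (dispatch p (pop n q))
continue p f (inj₁ b)       = b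
continue p f (inj₂ (n , q)) = eval p f n q

-- The increments left before a binary counter, least significant bit first and `true` for 1,
-- overflows; a counter of n zeros has 2 ^ n - 1 of them.
rem : List Bool → ℕ
rem []          = 0
rem (true ∷ l)  = rem l + rem l
rem (false ∷ l) = suc (rem l + rem l)

data ULabel : Set where
  setup parse₀ parse₁ parse₂ copyX copyX₁ sepX₁ sepX₂ consulting : ULabel
  rewindI copyZ copyZ₁ sepZ₁ sepZ₂ reply₀ reply₁ rewindT : ULabel
  rewindC rewindQ ticking unticking popping seeking counting skipping executing done : ULabel

finite-ULabel : Finite ULabel
finite-ULabel = retract index′
  (Vec.lookup (setup ∷ parse₀ ∷ parse₁ ∷ parse₂ ∷ copyX ∷ copyX₁ ∷ sepX₁ ∷ sepX₂ ∷ consulting ∷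
               rewindI ∷ copyZ ∷ copyZ₁ ∷ sepZ₁ ∷ sepZ₂ ∷ reply₀ ∷ reply₁ ∷ rewindT ∷
               rewindC ∷ rewindQ ∷ ticking ∷ unticking ∷ popping ∷ seeking ∷ counting ∷ skipping ∷ executing ∷ done ∷ []))
  (λ { setup → refl ; parse₀ → refl ; parse₁ → refl ; parse₂ → refl ; copyX → refl ; copyX₁ → refl
     ; sepX₁ → refl ; sepX₂ → refl ; consulting → refl ; rewindI → refl ; copyZ → refl ; copyZ₁ → refl
     ; sepZ₁ → refl ; sepZ₂ → refl ; reply₀ → refl ; reply₁ → refl ; rewindT → refl ; rewindC → refl
     ; rewindQ → refl ; ticking → refl ; unticking → refl ; popping → refl ; seeking → refl
     ; counting → refl ; skipping → refl ; executing → refl ; done → refl })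
  (finite-Fin 27)
  where
  index′ : ULabel → Fin 27
  index′ = λ
    { setup → Fin.# 0 ; parse₀ → Fin.# 1 ; parse₁ → Fin.# 2 ; parse₂ → Fin.# 3 ; copyX → Fin.# 4
    ; copyX₁ → Fin.# 5 ; sepX₁ → Fin.# 6 ; sepX₂ → Fin.# 7 ; consulting → Fin.# 8 ; rewindI → Fin.# 9
    ; copyZ → Fin.# 10 ; copyZ₁ → Fin.# 11 ; sepZ₁ → Fin.# 12 ; sepZ₂ → Fin.# 13 ; reply₀ → Fin.# 14
    ; reply₁ → Fin.# 15 ; rewindT → Fin.# 16 ; rewindC → Fin.# 17 ; rewindQ → Fin.# 18 ; ticking → Fin.# 19
    ; unticking → Fin.# 20 ; popping → Fin.# 21 ; seeking → Fin.# 22 ; counting → Fin.# 23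
    ; skipping → Fin.# 24 ; executing → Fin.# 25 ; done → Fin.# 26 }

decode : Bool → Bool → Bool → Maybe Token
decode false false b     = just (push b)
decode false true  false = just inc
decode false true  true  = just row
decode true  false b     = just (reply b)
decode true  true  _     = nothing

replyIndex : Bool → Fin 4
replyIndex false = Fin.# 2
replyIndex true  = Fin.# 3

⟦_⟧ : Token → Symbol 4
⟦ push b ⟧  = bit b
⟦ inc ⟧     = aux (Fin.# 0)
⟦ row ⟧     = aux (Fin.# 1)
⟦ reply b ⟧ = aux (replyIndex b)

Cell = Symbol 4

-- The Booleans hold bits of the token being parsed, and later the oracle's answer.
UState : Set
UState = ULabel × Bool × Bool

Write : Set
Write = Maybe Cell × Direction

resolve : Write → Cell → Cell × Direction
resolve (nothing , d) s = s , d
resolve (just s , d)  _ = s , d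

keep L R : Write
keep = nothing , stay
L    = nothing , left
R    = nothing , right

put : Cell → Write
put s = just s , right

wipe : Write
wipe = just blank , right

-- The tapes: the input, the program, the queue, the row counter (in unary) and
-- the clock (in binary).
act : (Vec Cell 5 → UState × Vec Write 5 × Maybe Bool) → Kind 5 4 UState
act f = ordinary λ v → let s , ws , out = f v in s , Vec.zipWith resolve ws v , out

fail : UState × Vec Write 5 × Maybe Bool
fail = (done , false , false) , keep ∷ keep ∷ keep ∷ keep ∷ keep ∷ [] , nothing

always : UState → Vec Write 5 → Kind 5 4 UState
always s ws = act λ _ → s , ws , nothing

universal : UState → Kind 5 4 UState
-- Moving right once leaves a stored blank on each work tape, the left delimiter required by
-- `Cursor`.
universal (setup , a , b) = always (parse₀ , a , b) (keep ∷ R ∷ R ∷ R ∷ R ∷ [])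
universal (parse₀ , a , b) = act λ
  { (bit c ∷ _) → (parse₁ , c , b) , R ∷ keep ∷ keep ∷ keep ∷ keep ∷ [] , nothing
  ; _           → fail }
universal (parse₁ , a , b) = act λ
  { (bit c ∷ _) → (parse₂ , a , c) , R ∷ keep ∷ keep ∷ keep ∷ keep ∷ [] , nothing
  ; _           → fail }
universal (parse₂ , a , b) = act λ
  { (bit c ∷ _) → parsed (decode a b c)
  ; _           → fail }
  where
  parsed : Maybe Token → UState × Vec Write 5 × Maybe Bool
  parsed (just t) = (parse₀ , false , false) , R ∷ put ⟦ t ⟧ ∷ keep ∷ keep ∷ keep ∷ [] , nothing
  parsed nothing  = (copyX , false , false) , R ∷ keep ∷ keep ∷ keep ∷ keep ∷ [] , nothing
universal (copyX , a , b) = act λ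
  { (bit false ∷ _) → (copyX , a , b) , R ∷ keep ∷ put (bit false) ∷ keep ∷ keep ∷ [] , just false
  ; (bit true ∷ _)  → (copyX₁ , a , b) , R ∷ keep ∷ put (bit true) ∷ keep ∷ keep ∷ [] , just true
  ; _               → (sepX₁ , a , b) , L ∷ keep ∷ put (bit true) ∷ keep ∷ keep ∷ [] , nothing }
universal (copyX₁ , a , b) = always (copyX , a , b) (keep ∷ keep ∷ put (bit false) ∷ keep ∷ keep ∷ [])
universal (sepX₁ , a , b) = always (sepX₂ , a , b) (keep ∷ keep ∷ put (bit true) ∷ keep ∷ keep ∷ [])
universal (sepX₂ , a , b) = always (consulting , a , b) (keep ∷ keep ∷ put (bit false) ∷ keep ∷ keep ∷ [])
universal (consulting , a , b) = querying λ c → rewindI , c , b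
universal (rewindI , a , b) = act λ
  { (bit _ ∷ _) → (rewindI , a , b) , L ∷ keep ∷ keep ∷ keep ∷ keep ∷ [] , nothing
  ; _           → (copyZ , a , b) , R ∷ keep ∷ keep ∷ keep ∷ keep ∷ [] , nothing }
-- Every input bit also puts a zero on the clock tape, which gives the clock |z| bits.
universal (copyZ , a , b) = act λ
  { (bit false ∷ _) → (copyZ , a , b) , R ∷ keep ∷ put (bit false) ∷ keep ∷ put (bit false) ∷ [] , nothing
  ; (bit true ∷ _)  → (copyZ₁ , a , b) , R ∷ keep ∷ put (bit true) ∷ keep ∷ put (bit false) ∷ [] , nothing
  ; _               → (sepZ₁ , a , b) , keep ∷ keep ∷ put (bit true) ∷ keep ∷ L ∷ [] , nothing }
universal (copyZ₁ , a , b) = always (copyZ , a , b) (keep ∷ keep ∷ put (bit false) ∷ keep ∷ keep ∷ [])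
universal (sepZ₁ , a , b) = always (sepZ₂ , a , b) (keep ∷ keep ∷ put (bit true) ∷ keep ∷ keep ∷ [])
universal (sepZ₂ , a , b) = always (reply₀ , a , b) (keep ∷ keep ∷ put (bit false) ∷ keep ∷ keep ∷ [])
universal (reply₀ , false , b) = always (rewindT , false , b) (keep ∷ L ∷ put (bit false) ∷ keep ∷ keep ∷ [])
universal (reply₀ , true , b) = always (reply₁ , true , b) (keep ∷ L ∷ put (bit true) ∷ keep ∷ keep ∷ [])
universal (reply₁ , a , b) = always (rewindT , a , b) (keep ∷ keep ∷ put (bit false) ∷ keep ∷ keep ∷ [])
universal (rewindT , a , b) = act λ
  { (_ ∷ _ ∷ _ ∷ _ ∷ bit _ ∷ []) → (rewindT , a , b) , keep ∷ keep ∷ keep ∷ keep ∷ L ∷ [] , nothing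
  ; _                            → (rewindC , a , b) , keep ∷ keep ∷ keep ∷ keep ∷ R ∷ [] , nothing }
universal (rewindC , a , b) = act λ
  { (_ ∷ blank ∷ _) → (rewindQ , a , b) , keep ∷ R ∷ L ∷ keep ∷ keep ∷ [] , nothing
  ; _               → (rewindC , a , b) , keep ∷ L ∷ keep ∷ keep ∷ keep ∷ [] , nothing }
universal (rewindQ , a , b) = act λ
  { (_ ∷ _ ∷ bit _ ∷ _) → (rewindQ , a , b) , keep ∷ keep ∷ L ∷ keep ∷ keep ∷ [] , nothing
  ; _                   → (ticking , a , b) , keep ∷ keep ∷ R ∷ keep ∷ keep ∷ [] , nothing }
universal (ticking , a , b) = act λ
  { (_ ∷ _ ∷ _ ∷ _ ∷ bit true ∷ [])  → (ticking , a , b) , keep ∷ keep ∷ keep ∷ keep ∷ put (bit false) ∷ [] , nothing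
  ; (_ ∷ _ ∷ _ ∷ _ ∷ bit false ∷ []) → (unticking , a , b) , keep ∷ keep ∷ keep ∷ keep ∷ (just (bit true) , left) ∷ [] , nothing
  ; _                                → fail }
universal (unticking , a , b) = act λ
  { (_ ∷ _ ∷ _ ∷ _ ∷ bit _ ∷ []) → (unticking , a , b) , keep ∷ keep ∷ keep ∷ keep ∷ L ∷ [] , nothing
  ; _                            → (popping , a , b) , keep ∷ keep ∷ keep ∷ keep ∷ R ∷ [] , nothing }
universal (popping , a , b) = act λ
  { (_ ∷ _ ∷ bit true ∷ _)  → (popping , a , b) , keep ∷ keep ∷ wipe ∷ put (bit true) ∷ keep ∷ [] , nothing
  ; (_ ∷ _ ∷ bit false ∷ _) → (seeking , a , b) , keep ∷ keep ∷ wipe ∷ L ∷ keep ∷ [] , nothing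
  ; _                       → fail }
universal (seeking , a , b) = act λ
  { (_ ∷ _ ∷ bit _ ∷ _) → (seeking , a , b) , keep ∷ keep ∷ R ∷ keep ∷ keep ∷ [] , nothing
  ; _                   → (counting , a , b) , keep ∷ keep ∷ keep ∷ keep ∷ keep ∷ [] , nothing }
universal (counting , a , b) = act λ
  { (_ ∷ _ ∷ _ ∷ bit _ ∷ _) → (skipping , a , b) , keep ∷ keep ∷ keep ∷ (just blank , left) ∷ keep ∷ [] , nothing
  ; _                       → (executing , a , b) , keep ∷ keep ∷ keep ∷ R ∷ keep ∷ [] , nothing }
universal (skipping , a , b) = act λ
  { (_ ∷ aux (suc zero) ∷ _) → (counting , a , b) , keep ∷ R ∷ keep ∷ keep ∷ keep ∷ [] , nothing
  ; (_ ∷ blank ∷ _)          → fail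
  ; _                        → (skipping , a , b) , keep ∷ R ∷ keep ∷ keep ∷ keep ∷ [] , nothing }
universal (executing , a , b) = act λ
  { (_ ∷ bit c ∷ _)                    → (executing , a , b) , keep ∷ R ∷ put (bit c) ∷ keep ∷ keep ∷ [] , nothing
  ; (_ ∷ aux zero ∷ _)                 → (executing , a , b) , keep ∷ R ∷ keep ∷ put (bit true) ∷ keep ∷ [] , nothing
  ; (_ ∷ aux (suc zero) ∷ _)           → (rewindC , a , b) , keep ∷ L ∷ keep ∷ keep ∷ keep ∷ [] , nothing
  ; (_ ∷ aux (suc (suc (suc zero))) ∷ _) → (done , true , b) , keep ∷ keep ∷ keep ∷ keep ∷ keep ∷ [] , nothing
  ; _                                  → fail }
universal (done , a , b) = halting a

module Loop (B : Language) (a b : Bool) (I : Tape 4) (baseC baseK baseT : List Cell) where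

  private
    module C = Cursor ⟦_⟧ baseC
    module T = Cursor {m = 4} bit baseT
    module Q = Cursor {m = 4} bit

  Re = Reach universal B
  Ha = Halts universal B

  hop : ∀ {c s I₁ C₁ Q₁ K₁ T₁ I₂ C₂ Q₂ K₂ T₂ w t qs d} →
    outcome universal c ≡ goto (conf s (I₁ ∷ C₁ ∷ Q₁ ∷ K₁ ∷ T₁ ∷ []) w) →
    I₁ ≡ I₂ → C₁ ≡ C₂ → Q₁ ≡ Q₂ → K₁ ≡ K₂ → T₁ ≡ T₂ →
    Re (conf s (I₂ ∷ C₂ ∷ Q₂ ∷ K₂ ∷ T₂ ∷ []) w) t qs d → Re c (suc t) qs d
  hop e refl refl refl refl refl r = move e r

  failed : ∀ {c t ts w} → outcome universal c ≡ goto (conf (done , false , false) ts w) → Ha c (suc t) [] false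
  failed e = _ , move e arrived , refl

  at : ULabel → Tape 4 → Tape 4 → Tape 4 → Tape 4 → Conf 5 4 UState
  at l C Q K T = conf (l , a , b) (I ∷ C ∷ Q ∷ K ∷ T ∷ []) []

  -- Wiping the counter leaves stored blanks to its right. Their number `r` is carried along only to
  -- name the tape exactly.
  counter counterLeft : ℕ → ℕ → Tape 4
  counter n r = tape (replicate n (bit true) ++ blank ∷ baseK) blank (replicate r blank)
  counterLeft zero    r = tape baseK blank (replicate r blank)
  counterLeft (suc n) r = tape (replicate n (bit true) ++ blank ∷ baseK) (bit true) (replicate r blank)

  counter-push : ∀ n r → writeMove (bit true , right) (counter n r) ≡ counter (suc n) (pred r)
  counter-push n zero    = refl
  counter-push n (suc r) = refl

  counter-left : ∀ n r → moveHead left (counter n r) ≡ counterLeft n (suc r)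
  counter-left zero    r = refl
  counter-left (suc n) r = refl

  counter-wipe : ∀ n r → writeMove (blank , left) (counterLeft (suc n) r) ≡ counterLeft n (suc r)
  counter-wipe zero    r = refl
  counter-wipe (suc n) r = refl

  counter-return : ∀ r → moveHead right (counterLeft 0 r) ≡ counter 0 (pred r)
  counter-return zero    = refl
  counter-return (suc r) = refl

  rewind-program : ∀ {baseQ n r T p} u c v w → u ʳ++ c ≡ p →
    Re (at rewindC (C.leftOf u c) (Q.cursor baseQ v w) (counter n r) T) (suc (length u)) []
       (at rewindQ (C.cursor [] p) (Q.leftOf baseQ v w) (counter n r) T)
  rewind-program [] c v w refl = hop refl refl (C.leftOf-right [] c) (Q.cursor-left _ v w) refl refl arrived
  rewind-program (push x ∷ u) c v w e = hop refl refl (C.cursor-left u (push x ∷ c)) refl refl refl (rewind-program u (push x ∷ c) v w e)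
  rewind-program (inc ∷ u) c v w e = hop refl refl (C.cursor-left u (inc ∷ c)) refl refl refl (rewind-program u (inc ∷ c) v w e)
  rewind-program (row ∷ u) c v w e = hop refl refl (C.cursor-left u (row ∷ c)) refl refl refl (rewind-program u (row ∷ c) v w e)
  rewind-program (reply x ∷ u) c v w e = hop refl refl (C.cursor-left u (reply x ∷ c)) refl refl refl (rewind-program u (reply x ∷ c) v w e)

  rewind-queue : ∀ {baseQ C K T q} v w → v ʳ++ w ≡ q →
    Re (at rewindQ C (Q.leftOf baseQ v w) K T) (suc (length v)) [] (at ticking C (Q.cursor baseQ [] q) K T)
  rewind-queue []      w refl = hop refl refl refl (Q.leftOf-right _ [] w) refl refl arrived
  rewind-queue (x ∷ v) w e    = hop refl refl refl (Q.cursor-left _ v (x ∷ w)) refl refl (rewind-queue v (x ∷ w) e)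

  rewind-clock : ∀ {C Q K l} v w → v ʳ++ w ≡ l →
    Re (at unticking C Q K (T.leftOf v w)) (suc (length v)) [] (at popping C Q K (T.cursor [] l))
  rewind-clock []      w refl = hop refl refl refl refl refl (T.leftOf-right [] w) arrived
  rewind-clock (x ∷ v) w e    = hop refl refl refl refl refl (T.cursor-left v (x ∷ w)) (rewind-clock v (x ∷ w) e)

  tick : ∀ {C Q K f} u l → rem l ≡ suc f → ∃[ l′ ] ∃[ v ] ∃[ w ]
    (Re (at ticking C Q K (T.cursor u l)) (suc (length l)) [] (at unticking C Q K (T.leftOf v w))
     × v ʳ++ w ≡ u ʳ++ l′ × rem l′ ≡ f × length l′ ≡ length l × length v ≤ length u + length l)
  tick u (false ∷ l) refl =
    true ∷ l , u , true ∷ l , hop refl refl refl refl refl (T.cursor-left u (true ∷ l)) arrived , refl , refl , refl , m≤m+n _ _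
  tick u (true ∷ l) e with rem l in eq
  tick u (true ∷ l) refl | suc f =
    let l′ , v , w , run , e₁ , e₂ , e₃ , le = tick (false ∷ u) l eq
    in false ∷ l′ , v , w , hop refl refl refl refl refl (T.cursor-right u false l) run , e₁
     , trans (cong (λ r → suc (r + r)) e₂) (sym (+-suc f f)) , cong suc e₃ , ≤-trans le (≤-reflexive (sym (+-suc (length u) (length l))))

  timeout : ∀ {C Q K} u l → rem l ≡ 0 → Ha (at ticking C Q K (T.cursor u l)) (suc (length l)) [] false
  timeout u []         e = failed refl
  timeout u (true ∷ l) e with rem l in eq
  timeout u (true ∷ l) refl | zero =
    let d , r , e = timeout (false ∷ u) l eq in d , hop refl refl refl refl refl (T.cursor-right u false l) r , e

  -- As for the stages after it, the abstract result decides the statement: failure is a halt with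
  -- `false`, success gives the configuration handed to the next stage with the size bounds that the
  -- timing of a round uses.
  PopSpec : Tape 4 → Tape 4 → List Cell → ℕ → ℕ → List Bool → Maybe (ℕ × List Bool) → Set
  PopSpec C T baseQ n r q nothing =
    Ha (at popping C (Q.cursor baseQ [] q) (counter n r) T) (suc (length q)) [] false
  PopSpec C T baseQ n r q (just (n′ , q′)) = ∃[ base ] ∃[ r′ ]
    (Re (at popping C (Q.cursor baseQ [] q) (counter n r) T) (suc (length q)) []
        (at seeking C (Q.cursor base [] q′) (counterLeft n′ r′) T)
     × n′ + length q′ ≤ n + length q × length q′ ≤ length q)

  wiped : ∀ base x q → writeMove (blank , right) (Q.cursor base [] (x ∷ q)) ≡ Q.cursor (blank ∷ base) [] q
  wiped base x []      = refl
  wiped base x (_ ∷ _) = refl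

  pop-spec : ∀ {C T} baseQ n r q → PopSpec C T baseQ n r q (pop n q)
  pop-spec baseQ n r [] = failed refl
  pop-spec {C} {T} baseQ n r (true ∷ q) with pop (suc n) q | pop-spec {C} {T} (blank ∷ baseQ) (suc n) (pred r) q
  ... | nothing | d , run , e = d , hop refl refl refl (wiped baseQ true q) (counter-push n r) refl run , e
  ... | just (n′ , q′) | base , r′ , run , le , le′ =
    base , r′ , hop refl refl refl (wiped baseQ true q) (counter-push n r) refl run
    , ≤-trans le (≤-reflexive (sym (+-suc n (length q)))) , ≤-trans le′ (n≤1+n _)
  pop-spec baseQ n r (false ∷ q) =
    blank ∷ baseQ , suc r , hop refl refl refl (wiped baseQ false q) (counter-left n r) refl arrived , +-monoʳ-≤ n (n≤1+n _) , n≤1+n _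

  seek-end : ∀ {C K T base v} u q → q ʳ++ u ≡ v →
    Re (at seeking C (Q.cursor base u q) K T) (suc (length q)) [] (at counting C (Q.cursor base v []) K T)
  seek-end u []      refl = hop refl refl refl refl refl refl arrived
  seek-end u (x ∷ q) e    = hop refl refl refl (Q.cursor-right _ u x q) refl refl (seek-end (x ∷ u) q e)

  SkipSpec : ULabel → Tape 4 → Tape 4 → List Token → Program → ℕ → ℕ → Maybe Program → Set
  SkipSpec s Q T u c n r nothing = Ha (at s (C.cursor u c) Q (counterLeft n r) T) (suc (length c + n)) [] false
  SkipSpec s Q T u c n r (just c′) = ∃[ v ] ∃[ r′ ]
    (Re (at s (C.cursor u c) Q (counterLeft n r) T) (suc (length c + n)) []
        (at executing (C.cursor v c′) Q (counter 0 r′) T)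
     × v ʳ++ c′ ≡ u ʳ++ c × length c′ ≤ length c)

  prepend : ∀ {s s′ Q T u u′ c c′ n n′ r r′} m {x y} →
    outcome universal (at s (C.cursor u c) Q (counterLeft n r) T) ≡ goto (at s′ x Q y T) →
    x ≡ C.cursor u′ c′ → y ≡ counterLeft n′ r′ →
    suc (length c′ + n′) ≤ length c + n → u′ ʳ++ c′ ≡ u ʳ++ c → length c′ ≤ length c →
    SkipSpec s′ Q T u′ c′ n′ r′ m → SkipSpec s Q T u c n r m
  prepend nothing  e eC eK t≤ _ _ (d , run , e′) =
    d , relax (s≤s t≤) (hop e refl eC refl eK refl run) , e′
  prepend (just _) e eC eK t≤ e₁ le (v , r , run , e₂ , le′) =
    v , r , relax (s≤s t≤) (hop e refl eC refl eK refl run) , trans e₂ e₁ , ≤-trans le′ le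

  skip-spec : ∀ {Q T} u c n r → SkipSpec counting Q T u c n r (skip n c)
  skipRow-spec : ∀ {Q T} u c n r → SkipSpec skipping Q T u c n r (skipRow n c)
  skip-spec u c zero    r = u , pred r , hop refl refl refl refl (counter-return r) refl arrived , refl , ≤-refl
  skip-spec u c (suc n) r =
    prepend (skipRow n c) refl refl (counter-wipe n r) (≤-reflexive (sym (+-suc (length c) n))) refl ≤-refl (skipRow-spec u c n (suc r))
  skipRow-spec u []                n r = failed refl
  skipRow-spec u (row ∷ c)         n r = prepend (skip n c) refl (C.cursor-right u row c) refl ≤-refl refl (n≤1+n _) (skip-spec (row ∷ u) c n r)
  skipRow-spec u (push x ∷ c)      n r = prepend (skipRow n c) refl (C.cursor-right u (push x) c) refl ≤-refl refl (n≤1+n _) (skipRow-spec (push x ∷ u) c n r)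
  skipRow-spec u (inc ∷ c)         n r = prepend (skipRow n c) refl (C.cursor-right u inc c) refl ≤-refl refl (n≤1+n _) (skipRow-spec (inc ∷ u) c n r)
  skipRow-spec u (reply false ∷ c) n r = prepend (skipRow n c) refl (C.cursor-right u (reply false) c) refl ≤-refl refl (n≤1+n _) (skipRow-spec (reply false ∷ u) c n r)
  skipRow-spec u (reply true ∷ c)  n r = prepend (skipRow n c) refl (C.cursor-right u (reply true) c) refl ≤-refl refl (n≤1+n _) (skipRow-spec (reply true ∷ u) c n r)

  ExecSpec : Tape 4 → List Cell → List Token → Program → List Bool → List Bool → ℕ → ℕ → Round → Set
  ExecSpec T base u c v q n r (inj₁ x) =
    Ha (at executing (C.cursor u c) (Q.cursor base v []) (counter n r) T) (suc (length c)) [] x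
  ExecSpec T base u c v q n r (inj₂ (n′ , q′)) = ∃[ u′ ] ∃[ c′ ] ∃[ v′ ] ∃[ r′ ]
    (Re (at executing (C.cursor u c) (Q.cursor base v []) (counter n r) T) (suc (length c)) []
        (at rewindC (C.leftOf u′ c′) (Q.cursor base v′ []) (counter n′ r′) T)
     × u′ ʳ++ c′ ≡ u ʳ++ c × reverse v′ ≡ q′ × n′ ≤ n + length c × length q′ ≤ length q + length c)

  prependᵉ : ∀ {T base u t c v w q p n m r s} ρ {x y z} →
    outcome universal (at executing (C.cursor u (t ∷ c)) (Q.cursor base v []) (counter n r) T) ≡ goto (at executing x y z T) →
    x ≡ C.cursor (t ∷ u) c → y ≡ Q.cursor base w [] → z ≡ counter m s →
    m + length c ≤ n + suc (length c) → length p + length c ≤ length q + suc (length c) →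
    ExecSpec T base (t ∷ u) c w p m s ρ → ExecSpec T base u (t ∷ c) v q n r ρ
  prependᵉ (inj₁ x) e eC eQ eK _ _ (d , run , e′) = d , hop e refl eC eQ eK refl run , e′
  prependᵉ (inj₂ _) e eC eQ eK le₁ le₂ (u , c , v , r , run , e₁ , e₂ , le , le′) =
    u , c , v , r , hop e refl eC eQ eK refl run , e₁ , e₂ , ≤-trans le le₁ , ≤-trans le′ le₂

  exec-spec : ∀ {T base} u c v q n r → reverse v ≡ q → ExecSpec T base u c v q n r (exec c q n)
  exec-spec u []            v q n r e = failed refl
  exec-spec u (push x ∷ c)  v q n r e =
    prependᵉ {w = x ∷ v} {q = q} {p = q ++ x ∷ []} (exec c (q ++ x ∷ []) n) refl (C.cursor-right u (push x) c) refl refl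
      (+-monoʳ-≤ n (n≤1+n _)) (≤-reflexive longer)
      (exec-spec (push x ∷ u) c (x ∷ v) (q ++ x ∷ []) n r (trans (List.unfold-reverse x v) (cong (_++ x ∷ []) e)))
    where
    longer : length (q ++ x ∷ []) + length c ≡ length q + suc (length c)
    longer = trans (cong (_+ length c) (List.length-++ q)) (+-assoc (length q) 1 (length c))
  exec-spec u (inc ∷ c)     v q n r e =
    prependᵉ {w = v} {q = q} {p = q} (exec c q (suc n)) refl (C.cursor-right u inc c) refl (counter-push n r)
      (≤-reflexive (sym (+-suc n (length c)))) (+-monoʳ-≤ (length q) (n≤1+n _)) (exec-spec (inc ∷ u) c v q (suc n) (pred r) e)
  exec-spec u (row ∷ c)     v q n r e =
    u , row ∷ c , v , r , hop refl refl (C.cursor-left u (row ∷ c)) refl refl refl arrived , refl , e , m≤m+n n _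
    , m≤m+n (length q) _
  exec-spec u (reply false ∷ c) v q n r e = failed refl
  exec-spec u (reply true ∷ c)  v q n r e = _ , move refl arrived , refl

  module _ (p : Program) (N X : ℕ) (p≤N : length p ≤ N) where

    -- The cost of a round: N + 1 each for rewinding the program, ticking, rewinding the clock and
    -- executing the row; X + 1 each for rewinding the queue, popping and seeking its end; 2N + X +
    -- 1 for finding the row, as the counter may hold N + X.
    W : ℕ
    W = N * 6 + X * 4 + 8

    -- A row is part of the program, so a round pushes at most `length p` bits and leaves at most
    -- `length p` in the counter. Thus `length q + f * length p` does not grow while f counts down,
    -- and X bounds the queue in all rounds to come.
    Loops : ℕ → Set
    Loops f = ∀ {base} u c v n r l q → u ʳ++ c ≡ p → reverse v ≡ q → rem l ≡ f →
      length l ≤ N → n ≤ N → length q + f * length p ≤ X →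
      Ha (at rewindC (C.leftOf u c) (Q.cursor base v []) (counter n r) (T.cursor [] l)) (suc f * W) [] (eval p f n q)

    after-exec : ∀ f ρ {base u c v q n r l} → Loops f → u ʳ++ c ≡ p → rem l ≡ f → length l ≤ N → n + length c ≤ N →
      length c ≤ length p → length q + suc f * length p ≤ X →
      ExecSpec (T.cursor [] l) base u c v q n r ρ →
      Ha (at executing (C.cursor u c) (Q.cursor base v []) (counter n r) (T.cursor [] l)) (suc N + suc f * W) [] (continue p f ρ)
    after-exec f (inj₁ x) _ _ _ _ _ c≤ _ h = relaxʰ (m≤n⇒m≤n+o (suc f * W) (s≤s (≤-trans c≤ p≤N))) h
    after-exec f (inj₂ (n′ , q′)) {q = q} {l = l} loop e reml l≤ n≤ c≤ q≤ (u′ , c′ , v′ , r′ , run , e₁ , e₂ , le₁ , le₂) =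
      relax (s≤s (≤-trans c≤ p≤N)) run ▷ʰ
      loop u′ c′ v′ n′ r′ l q′ (trans e₁ e) e₂ reml l≤ (≤-trans le₁ n≤)
        (≤-trans (+-monoˡ-≤ (f * length p) (≤-trans le₂ (+-monoʳ-≤ (length q) c≤)))
                 (≤-trans (≤-reflexive (+-assoc (length q) (length p) (f * length p))) q≤))

    after-skip : ∀ f m {base v q n r l} → Loops f → reverse v ≡ q → rem l ≡ f → length l ≤ N → n ≤ N + X →
      length q + suc f * length p ≤ X →
      SkipSpec counting (Q.cursor base v []) (T.cursor [] l) [] p n r m →
      Ha (at counting (C.cursor [] p) (Q.cursor base v []) (counterLeft n r) (T.cursor [] l))
         (suc (N + (N + X)) + (suc N + suc f * W)) [] (continue p f (runRow m q))
    after-skip f nothing _ _ _ _ n≤ _ h = relaxʰ (m≤n⇒m≤n+o (suc N + suc f * W) (s≤s (+-mono-≤ p≤N n≤))) h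
    after-skip f (just c) {v = v} {q} loop e reml l≤ n≤ q≤ (u , r , run , e₁ , c≤) =
      relax (s≤s (+-mono-≤ p≤N n≤)) run ▷ʰ
      after-exec f (exec c q 0) {q = q} loop e₁ reml l≤ (≤-trans c≤ p≤N) c≤ q≤ (exec-spec u c v q 0 r e)

    after-pop : ∀ f m {base q n r l} → Loops f → rem l ≡ f → length l ≤ N → n ≤ N →
      length q + suc f * length p ≤ X →
      PopSpec (C.cursor [] p) (T.cursor [] l) base n r q m →
      Ha (at popping (C.cursor [] p) (Q.cursor base [] q) (counter n r) (T.cursor [] l))
         (suc X + (suc X + (suc (N + (N + X)) + (suc N + suc f * W)))) [] (continue p f (dispatch p m))
    after-pop f nothing {q = q} _ _ _ _ q≤ h = relaxʰ (m≤n⇒m≤n+o _ (s≤s (≤-trans (m≤m+n (length q) _) q≤))) h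
    after-pop f (just (n′ , q′)) {q = q} {n} loop reml l≤ n≤ q≤ (base′ , r′ , run , le , le′) =
      relax (s≤s (≤-trans (m≤m+n (length q) _) q≤)) run ▷ʰ
      relax (s≤s (≤-trans (m≤m+n (length q′) _) q′≤)) (seek-end [] q′ refl) ▷ʰ
      after-skip f (skip n′ p) loop (List.reverse-involutive q′) reml l≤
        (≤-trans (m≤m+n n′ _) (≤-trans le (+-mono-≤ n≤ (≤-trans (m≤m+n (length q) _) q≤)))) q′≤ (skip-spec [] p n′ r′)
      where
      q′≤ : length q′ + suc f * length p ≤ X
      q′≤ = ≤-trans (+-monoˡ-≤ (suc f * length p) le′) q≤

    loop : ∀ f → Loops f
    loop f u c v n r l q refl refl reml l≤ n≤ q≤ =
      relaxʰ (bound f) (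
        relax (s≤s (≤-trans u≤ p≤N)) (rewind-program u c v [] refl) ▷ʰ
        relax (s≤s (≤-trans (≤-reflexive (sym (List.length-reverse v))) (≤-trans (m≤m+n _ (f * length p)) q≤)))
              (rewind-queue v [] refl) ▷ʰ
        clock f reml q≤)
      where
      u≤ : length u ≤ length p
      u≤ = ≤-slack (length c) (sym (List.length-ʳ++ u))
      rest : ℕ → ℕ
      rest zero    = suc N
      rest (suc f) = suc N + (suc N + (suc X + (suc X + (suc (N + (N + X)) + (suc N + suc f * W)))))
      clock : ∀ f → rem l ≡ f → length q + f * length p ≤ X → ∀ {base} →
        Ha (at ticking (C.cursor [] p) (Q.cursor base [] q) (counter n r) (T.cursor [] l)) (rest f) [] (eval p f n q)
      clock zero    e _ = relaxʰ (s≤s l≤) (timeout [] l e)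
      clock (suc f) e q≤ with tick [] l e
      ... | l′ , v , w , run , e₁ , e₂ , e₃ , le =
        relax (s≤s l≤) run ▷ʰ
        relax (s≤s (≤-trans le l≤)) (rewind-clock v w e₁) ▷ʰ
        after-pop f (pop n q) (loop f) e₂ (≤-trans (≤-reflexive e₃) l≤) n≤ q≤ (pop-spec _ n r q)
      bound : ∀ f → suc N + (suc X + rest f) ≤ suc f * W
      bound zero = ≤-slack (N * 4 + X * 3 + 5) (arith N X)
        where
        arith : ∀ n x → suc n + (suc x + suc n) + (n * 4 + x * 3 + 5) ≡ 1 * (n * 6 + x * 4 + 8)
        arith = solve-∀
      bound (suc f) = ≤-reflexive (arith N X (suc f * W))
        where
        arith : ∀ n x y → suc n + (suc x + (suc n + (suc n + (suc x + (suc x + (suc (n + (n + x)) + (suc n + y))))))) ≡ n * 6 + x * 4 + 8 + y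
        arith = solve-∀

-- Setting up the universal machine, and the diagonal set it decides

encode : Word → List Bool
encode []          = []
encode (false ∷ w) = false ∷ encode w
encode (true ∷ w)  = true ∷ false ∷ encode w

-- Together with `encode` these are the unary codes 0, 10, 110 of `input false`, `input true` and
-- `inputEnd`.
separator : List Bool
separator = true ∷ true ∷ false ∷ []

length-encode : ∀ w → length (encode w) ≤ length w * 2
length-encode []          = z≤n
length-encode (false ∷ w) = s≤s (≤-trans (length-encode w) (n≤1+n _))
length-encode (true ∷ w)  = s≤s (s≤s (length-encode w))

initialQueue : Word → Word → Bool → List Bool
initialQueue x z a = encode x ++ separator ++ encode z ++ separator ++ encode (a ∷ [])

parse : Word → Maybe (Program × Word)
parsed : Maybe Token → Word → Maybe (Program × Word)
prefixed : Token → Maybe (Program × Word) → Maybe (Program × Word)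
parse []              = nothing
parse (a ∷ [])        = nothing
parse (a ∷ b ∷ [])    = nothing
parse (a ∷ b ∷ c ∷ w) = parsed (decode a b c) w
parsed nothing  w = just ([] , w)
parsed (just t) w = prefixed t (parse w)
prefixed t nothing        = nothing
prefixed t (just (p , w)) = just (t ∷ p , w)

clock : Word → List Bool
clock = List.map (λ _ → false)

rem-clock : ∀ z → suc (rem (clock z)) ≡ 2 ^ length z
rem-clock []      = refl
rem-clock (_ ∷ z) = trans (arith (rem (clock z))) (cong (2 *_) (rem-clock z))
  where
  arith : ∀ r → suc (suc (r + r)) ≡ 2 * suc r
  arith = solve-∀

interpret : Language → Word → Maybe (Program × Word) → Bool
interpret B z nothing        = false
interpret B z (just (p , x)) = eval p (rem (clock z)) 0 (initialQueue x z (B x))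

asks : Maybe (Program × Word) → List Word
asks nothing        = []
asks (just (p , x)) = x ∷ []

-- The initial queue has two words of at most n bits, each bit doubled at worst, two separators and
-- the reply; each of fewer than 2 ^ n rounds then adds at most n, the bound on the program length.
queueBound : ℕ → ℕ
queueBound n = n * 4 + 8 + 2 ^ n * n

-- The linear part pays for the setup. The factor of 2 ^ n is the cost `Loop.W` of a round for N = n
-- and X = `queueBound n`.
universalTime : ℕ → ℕ
universalTime n = n * 7 + 15 + 2 ^ n * (n * 6 + queueBound n * 4 + 8)

module Setup (B : Language) where

  private
    module C = Cursor ⟦_⟧ []
    module V = Cursor {m = 4} bit []

  Reₛ = Reach universal B
  Haₛ = Halts universal B

  hopₛ : ∀ {c s I₁ C₁ Q₁ K₁ T₁ I₂ C₂ Q₂ K₂ T₂ w w₂ t qs d} →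
    outcome universal c ≡ goto (conf s (I₁ ∷ C₁ ∷ Q₁ ∷ K₁ ∷ T₁ ∷ []) w) →
    I₁ ≡ I₂ → C₁ ≡ C₂ → Q₁ ≡ Q₂ → K₁ ≡ K₂ → T₁ ≡ T₂ → w ≡ w₂ →
    Reₛ (conf s (I₂ ∷ C₂ ∷ Q₂ ∷ K₂ ∷ T₂ ∷ []) w₂) t qs d → Reₛ c (suc t) qs d
  hopₛ e refl refl refl refl refl refl r = move e r

  K₀ : Tape 4
  K₀ = tape (blank ∷ []) blank []

  ParseSpec : Word → List Token → Word → Maybe (Program × Word) → Set
  ParseSpec h u z nothing = ∀ {a b} →
    Haₛ (conf (parse₀ , a , b) (reading h z ∷ C.cursor u [] ∷ V.cursor [] [] ∷ K₀ ∷ V.cursor [] [] ∷ []) []) (suc (length z)) [] false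
  ParseSpec h u z (just (p , x)) = ∃[ h′ ] ((∀ {a b} →
    Reₛ (conf (parse₀ , a , b) (reading h z ∷ C.cursor u [] ∷ V.cursor [] [] ∷ K₀ ∷ V.cursor [] [] ∷ []) []) (suc (length z)) []
        (conf (copyX , false , false) (reading h′ x ∷ C.cursor (p ʳ++ u) [] ∷ V.cursor [] [] ∷ K₀ ∷ V.cursor [] [] ∷ []) []))
    × h′ ʳ++ x ≡ h ʳ++ z × length x < length z × length p ≤ length z)

  parse-spec : ∀ h u z → ParseSpec h u z (parse z)
  parse-spec h u [] = _ , move refl arrived , refl
  parse-spec h u (x ∷ []) = _ , move refl (move refl arrived) , refl
  parse-spec h u (x ∷ y ∷ []) = _ , move refl (move refl (move refl arrived)) , refl
  parse-spec h u (x ∷ y ∷ z ∷ w) with decode x y z in eq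
  ... | nothing = z ∷ y ∷ x ∷ h
                , hopₛ refl (reading-right h x (y ∷ z ∷ w)) refl refl refl refl refl
                   (hopₛ refl (reading-right (x ∷ h) y (z ∷ w)) refl refl refl refl refl
                   (hopₛ last (reading-right (y ∷ x ∷ h) z w) refl refl refl refl refl arrived))
                , refl , s≤s (≤-trans (n≤1+n _) (n≤1+n _)) , z≤n
    where
    last : outcome universal (conf (parse₂ , x , y) (reading (y ∷ x ∷ h) (z ∷ w) ∷ C.cursor u [] ∷ V.cursor [] [] ∷ K₀ ∷ V.cursor [] [] ∷ []) [])
           ≡ goto (conf (copyX , false , false) (moveHead right (reading (y ∷ x ∷ h) (z ∷ w)) ∷ C.cursor u [] ∷ V.cursor [] [] ∷ K₀ ∷ V.cursor [] [] ∷ []) [])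
    last rewrite eq = refl
  ... | just t with parse w | parse-spec (z ∷ y ∷ x ∷ h) (t ∷ u) w
  ...   | nothing | spec = let d , run , e = spec in
              d , hopₛ refl (reading-right h x (y ∷ z ∷ w)) refl refl refl refl refl
                   (hopₛ refl (reading-right (x ∷ h) y (z ∷ w)) refl refl refl refl refl
                   (hopₛ last (reading-right (y ∷ x ∷ h) z w) refl refl refl refl refl run)) , e
    where
    last : outcome universal (conf (parse₂ , x , y) (reading (y ∷ x ∷ h) (z ∷ w) ∷ C.cursor u [] ∷ V.cursor [] [] ∷ K₀ ∷ V.cursor [] [] ∷ []) [])
           ≡ goto (conf (parse₀ , false , false) (moveHead right (reading (y ∷ x ∷ h) (z ∷ w)) ∷ C.cursor (t ∷ u) [] ∷ V.cursor [] [] ∷ K₀ ∷ V.cursor [] [] ∷ []) [])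
    last rewrite eq = refl
  ...   | just (p , v) | h′ , run , e , x< , p≤ = h′
              , hopₛ refl (reading-right h x (y ∷ z ∷ w)) refl refl refl refl refl
                   (hopₛ refl (reading-right (x ∷ h) y (z ∷ w)) refl refl refl refl refl
                   (hopₛ last (reading-right (y ∷ x ∷ h) z w) refl refl refl refl refl run))
              , e , ≤-trans x< (m≤n+m _ 3) , s≤s (≤-trans p≤ (m≤n+m _ 2))
    where
    last : outcome universal (conf (parse₂ , x , y) (reading (y ∷ x ∷ h) (z ∷ w) ∷ C.cursor u [] ∷ V.cursor [] [] ∷ K₀ ∷ V.cursor [] [] ∷ []) [])
           ≡ goto (conf (parse₀ , false , false) (moveHead right (reading (y ∷ x ∷ h) (z ∷ w)) ∷ C.cursor (t ∷ u) [] ∷ V.cursor [] [] ∷ K₀ ∷ V.cursor [] [] ∷ []) [])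
    last rewrite eq = refl

  copy-short : ∀ {C K T a b q} h x v w → w ++ x ≡ q →
    Reₛ (conf (copyX , a , b) (reading h x ∷ C ∷ V.cursor v [] ∷ K ∷ T ∷ []) w) (length x * 2 + 3) []
        (conf (consulting , a , b) (backing (x ʳ++ h) [] ∷ C ∷ V.cursor (separator ʳ++ (encode x ʳ++ v)) [] ∷ K ∷ T ∷ []) q)
  copy-short h [] v w e =
    hopₛ refl (reading-end h) refl refl refl refl e
    (hopₛ refl refl refl refl refl refl (List.++-identityʳ _)
    (hopₛ refl refl refl refl refl refl (List.++-identityʳ _) arrived))
  copy-short h (false ∷ x) v w e =
    relax (n≤1+n _) (hopₛ refl (reading-right h false x) refl refl refl refl refl
      (copy-short (false ∷ h) x (false ∷ v) (w ++ false ∷ []) (trans (List.++-assoc w (false ∷ []) x) e)))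
  copy-short h (true ∷ x) v w e =
    hopₛ refl (reading-right h true x) refl refl refl refl refl
    (hopₛ refl refl refl refl refl refl (List.++-identityʳ _)
      (copy-short (true ∷ h) x (false ∷ true ∷ v) (w ++ true ∷ []) (trans (List.++-assoc w (true ∷ []) x) e)))

  rewind-input : ∀ {C Q K T a b z} u r → u ʳ++ r ≡ z →
    Reₛ (conf (rewindI , a , b) (backing u r ∷ C ∷ Q ∷ K ∷ T ∷ []) []) (suc (length u)) []
        (conf (copyZ , a , b) (V.cursor [] z ∷ C ∷ Q ∷ K ∷ T ∷ []) [])
  rewind-input []      r refl = hopₛ refl (V.leftOf-right [] r) refl refl refl refl refl arrived
  rewind-input (x ∷ u) r e    = hopₛ refl (backing-left x u r) refl refl refl refl refl (rewind-input u (x ∷ r) e)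

  copy-long : ∀ {C K a b} u r v l →
    Reₛ (conf (copyZ , a , b) (V.cursor u r ∷ C ∷ V.cursor v [] ∷ K ∷ V.cursor l [] ∷ []) []) (length r * 2 + 3) []
        (conf (reply₀ , a , b)
              (V.cursor (r ʳ++ u) [] ∷ C ∷ V.cursor (separator ʳ++ (encode r ʳ++ v)) [] ∷ K ∷ V.leftOf (clock r ʳ++ l) [] ∷ []) [])
  copy-long u [] v l =
    hopₛ refl refl refl refl refl (V.cursor-left l []) refl
    (hopₛ refl refl refl refl refl refl refl
    (hopₛ refl refl refl refl refl refl refl arrived))
  copy-long u (false ∷ r) v l =
    relax (n≤1+n _) (hopₛ refl (V.cursor-right u false r) refl refl refl refl refl (copy-long (false ∷ u) r (false ∷ v) (false ∷ l)))
  copy-long u (true ∷ r) v l =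
    hopₛ refl (V.cursor-right u true r) refl refl refl refl refl
    (hopₛ refl refl refl refl refl refl refl (copy-long (true ∷ u) r (false ∷ true ∷ v) (false ∷ l)))

  copy-reply : ∀ {I K T b} u v a →
    Reₛ (conf (reply₀ , a , b) (I ∷ C.cursor u [] ∷ V.cursor v [] ∷ K ∷ T ∷ []) []) 2 []
        (conf (rewindT , a , b) (I ∷ C.leftOf u [] ∷ V.cursor (encode (a ∷ []) ʳ++ v) [] ∷ K ∷ T ∷ []) [])
  copy-reply u v false = hopₛ refl refl (C.cursor-left u []) refl refl refl refl arrived
  copy-reply u v true  = hopₛ refl refl (C.cursor-left u []) refl refl refl refl (hopₛ refl refl refl refl refl refl refl arrived)

  rewind-fresh-clock : ∀ {I C Q K a b l} u r → u ʳ++ r ≡ l →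
    Reₛ (conf (rewindT , a , b) (I ∷ C ∷ Q ∷ K ∷ V.leftOf u r ∷ []) []) (suc (length u)) []
        (conf (rewindC , a , b) (I ∷ C ∷ Q ∷ K ∷ V.cursor [] l ∷ []) [])
  rewind-fresh-clock []      r refl = hopₛ refl refl refl refl refl (V.leftOf-right [] r) refl arrived
  rewind-fresh-clock (x ∷ u) r e    = hopₛ refl refl refl refl refl (V.cursor-left u (x ∷ r)) refl (rewind-fresh-clock u (x ∷ r) e)

  queue-written : ∀ x z a →
    reverse (encode (a ∷ []) ʳ++ (separator ʳ++ (encode z ʳ++ (separator ʳ++ (encode x ʳ++ []))))) ≡ initialQueue x z a
  queue-written x z a = begin
    reverse (encode (a ∷ []) ʳ++ (separator ʳ++ (encode z ʳ++ (separator ʳ++ (encode x ʳ++ [])))))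
      ≡⟨ List.ʳ++-ʳ++ (encode (a ∷ [])) ⟩
    (separator ʳ++ (encode z ʳ++ (separator ʳ++ (encode x ʳ++ [])))) ʳ++ (encode (a ∷ []) ++ [])
      ≡⟨⟩
    (encode z ʳ++ (separator ʳ++ (encode x ʳ++ []))) ʳ++ (separator ++ encode (a ∷ []) ++ [])
      ≡⟨ List.ʳ++-ʳ++ (encode z) ⟩
    (separator ʳ++ (encode x ʳ++ [])) ʳ++ (encode z ++ separator ++ encode (a ∷ []) ++ [])
      ≡⟨⟩
    (encode x ʳ++ []) ʳ++ (separator ++ encode z ++ separator ++ encode (a ∷ []) ++ [])
      ≡⟨ List.ʳ++-ʳ++ (encode x) ⟩
    encode x ++ separator ++ encode z ++ separator ++ encode (a ∷ []) ++ []
      ≡⟨ cong (λ w → encode x ++ separator ++ encode z ++ separator ++ w) (List.++-identityʳ (encode (a ∷ []))) ⟩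
    initialQueue x z a ∎
    where open ≡-Reasoning

  length-initialQueue : ∀ x z a → length (initialQueue x z a) ≤ length x * 2 + length z * 2 + 8
  length-initialQueue x z a = begin
    length (initialQueue x z a)
      ≡⟨ List.length-++ (encode x) ⟩
    length (encode x) + (3 + length (encode z ++ separator ++ encode (a ∷ [])))
      ≡⟨ cong (λ l → length (encode x) + (3 + l)) (List.length-++ (encode z)) ⟩
    length (encode x) + (3 + (length (encode z) + (3 + length (encode (a ∷ [])))))
      ≤⟨ +-mono-≤ (length-encode x) (+-monoʳ-≤ 3 (+-mono-≤ (length-encode z) (+-monoʳ-≤ 3 (length-encode (a ∷ []))))) ⟩
    length x * 2 + (3 + (length z * 2 + (3 + 2)))
      ≡⟨ arith (length x) (length z) ⟩
    length x * 2 + length z * 2 + 8 ∎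
    where
    open ≤-Reasoning
    arith : ∀ a b → a * 2 + (3 + (b * 2 + (3 + 2))) ≡ a * 2 + b * 2 + 8
    arith = solve-∀

  universal-halts : ∀ z →
    Haₛ (conf (setup , false , false) (inputTape z ∷ Vec.replicate 4 blankTape) [])
        (universalTime (length z)) (asks (parse z)) (interpret B z (parse z))
  universal-halts z =
    subst (λ I → Haₛ (conf (setup , false , false) (I ∷ Vec.replicate 4 blankTape) [])
                    (universalTime (length z)) (asks (parse z)) (interpret B z (parse z))) (reading-input z)
      (run (parse z) (parse-spec [] [] z))
    where
    N = length z
    run : ∀ m → ParseSpec [] [] z m →
      Haₛ (conf (setup , false , false) (reading [] z ∷ Vec.replicate 4 blankTape) [])
          (universalTime (length z)) (asks m) (interpret B z m)
    run nothing spec =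
      relaxʰ (m≤n⇒m≤n+o _ (≤-slack (N * 6 + 13) (arith N)))
        (move refl (arrived {t = 0}) ▷ʰ spec)
      where
      arith : ∀ n → 1 + suc n + (n * 6 + 13) ≡ n * 7 + 15
      arith = solve-∀
    run (just (p , x)) (h′ , parsing , e , x< , p≤) =
      relaxʰ bound
        (move refl (arrived {t = 0}) ▷ʰ
         parsing ▷ʰ
         copy-short h′ x [] [] refl ▷ʰ
         query refl (arrived {t = 0}) ▷ʰ
         rewind-input (x ʳ++ h′) [] z≡ ▷ʰ
         copy-long [] z (separator ʳ++ (encode x ʳ++ [])) [] ▷ʰ
         copy-reply (reverse p) (separator ʳ++ (encode z ʳ++ (separator ʳ++ (encode x ʳ++ [])))) (B x) ▷ʰ
         relax (s≤s (≤-reflexive (trans (List.length-reverse (clock z)) (List.length-map _ z))))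
           (rewind-fresh-clock (reverse (clock z)) [] (List.reverse-involutive (clock z))) ▷ʰ
         Loop.loop B (B x) false (V.cursor (reverse z) []) [] [] [] p N (queueBound N) p≤ (rem (clock z))
           (reverse p) [] (encode (B x ∷ []) ʳ++ (separator ʳ++ (encode z ʳ++ (separator ʳ++ (encode x ʳ++ [])))))
           0 0 (clock z) (initialQueue x z (B x))
           (List.reverse-involutive p) (queue-written x z (B x)) refl (≤-reflexive (List.length-map _ z)) z≤n queue≤)
      where
      z≡ : (x ʳ++ h′) ʳ++ [] ≡ z
      z≡ = trans (List.ʳ++-ʳ++ x) (trans (cong (h′ ʳ++_) (List.++-identityʳ x)) e)
      queue≤ : length (initialQueue x z (B x)) + rem (clock z) * length p ≤ queueBound N
      queue≤ = +-mono-≤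
        (≤-trans (length-initialQueue x z (B x))
          (≤-trans (+-monoˡ-≤ 8 (+-monoˡ-≤ (N * 2) (*-monoˡ-≤ 2 (<⇒≤ x<)))) (≤-reflexive (arith N))))
        (*-mono-≤ (≤-trans (n≤1+n _) (≤-reflexive (rem-clock z))) p≤)
        where
        arith : ∀ n → n * 2 + n * 2 + 8 ≡ n * 4 + 8
        arith = solve-∀
      E = 2 ^ N * (N * 6 + queueBound N * 4 + 8)
      bound : 1 + (suc N + (length x * 2 + 3 + (1 + (suc (length (x ʳ++ h′)) + (N * 2 + 3 + (2 + (suc N +
                suc (rem (clock z)) * (N * 6 + queueBound N * 4 + 8)))))))) ≤ universalTime N
      bound = begin
        1 + (suc N + (length x * 2 + 3 + (1 + (suc (length (x ʳ++ h′)) + (N * 2 + 3 + (2 + (suc N +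
          suc (rem (clock z)) * (N * 6 + queueBound N * 4 + 8))))))))
          ≡⟨ arith₁ N (length x) (length (x ʳ++ h′)) _ ⟩
        length x * 2 + length (x ʳ++ h′) + (N * 4 + 13) + suc (rem (clock z)) * (N * 6 + queueBound N * 4 + 8)
          ≤⟨ +-mono-≤ (+-monoˡ-≤ (N * 4 + 13) (+-mono-≤ (*-monoˡ-≤ 2 (<⇒≤ x<)) (≤-reflexive x+h)))
                      (≤-reflexive (cong (_* (N * 6 + queueBound N * 4 + 8)) (rem-clock z))) ⟩
        N * 2 + N + (N * 4 + 13) + E
          ≤⟨ +-monoˡ-≤ E (≤-slack 2 (arith₂ N)) ⟩
        universalTime N ∎
        where
        open ≤-Reasoning
        x+h : length (x ʳ++ h′) ≡ N
        x+h = trans (List.length-ʳ++ x) (trans (+-comm (length x) (length h′)) (trans (sym (List.length-ʳ++ h′)) (cong length e)))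
        arith₁ : ∀ n x y e → 1 + (suc n + (x * 2 + 3 + (1 + (suc y + (n * 2 + 3 + (2 + (suc n + e))))))) ≡ x * 2 + y + (n * 4 + 13) + e
        arith₁ = solve-∀
        arith₂ : ∀ n → n * 2 + n + (n * 4 + 13) + 2 ≡ n * 7 + 15
        arith₂ = solve-∀

finite-UState : Finite UState
finite-UState = finite-ULabel finite-× finite-Bool finite-× finite-Bool

universalMachine : OracleTM
universalMachine = machine finite-UState (setup , false , false) universal

-- Total, because the clock bounds every evaluation: malformed words, failing programs and expired
-- clocks all give `false`.
diagonal : Language → Language
diagonal B z = interpret B z (parse z)

universal-run : ∀ B z → ∃[ t ] (RunOn universalMachine B z t (asks (parse z)) (diagonal B z) × t ≤ universalTime (length z))
universal-run B z = machine-run finite-UState (setup , false , false) universal (Setup.universal-halts B z)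

-- At least the three bits of the end marker precede x.
parse-shorter : ∀ z → All (λ w → length w < length z) (asks (parse z))
parse-shorter z with parse z | Setup.parse-spec (λ _ → false) [] [] z
... | nothing      | _ = []
... | just (p , x) | _ , _ , _ , x< , _ = x< ∷ []

-- Compiling a queue machine into a program

module Encoding {P Γ : Set} (FP : Finite P) (FΓ : Finite Γ) (δ : P → Γ → (P × List Γ) ⊎ Bool) (padding : ℕ) where

  open QueueMachine δ

  private
    K : ℕ
    K = size FΓ

  -- The i-th glyph is coded as 1ⁱ0, so that popping it adds i to the row counter.
  code : Γ → List Bool
  code γ = replicate (toℕ (index FΓ γ)) true ++ false ∷ []

  codes : List Γ → List Bool
  codes []      = []
  codes (γ ∷ w) = code γ ++ codes w

  codes-++ : ∀ u w → codes (u ++ w) ≡ codes u ++ codes w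
  codes-++ []      w = refl
  codes-++ (γ ∷ u) w = trans (cong (code γ ++_) (codes-++ u w)) (sym (List.++-assoc (code γ) (codes u) (codes w)))

  -- Rows are ordered lexicographically, first by phase and then by glyph. The `inc`s of a row put
  -- the address of the next phase into the counter, and the pop adds the number of the glyph.
  address : P → ℕ
  address p = K * toℕ (index FP p)

  tokens : (P × List Γ) ⊎ Bool → Program
  tokens (inj₁ (p , w)) = List.map push (codes w) ++ replicate (address p) inc ++ row ∷ []
  -- `reply` halts before this `row` is reached; it is there because skipping counts the ends of
  -- rows.
  tokens (inj₂ b)       = reply b ∷ row ∷ []

  rowAt : Fin (size FP * K) → Program
  rowAt i = let p , γ = Fin.remQuot {size FP} K i in tokens (δ (element FP p) (element FΓ γ))

  rows : ∀ {n} → (Fin n → Program) → Program → Program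
  rows {zero}  f r = r
  rows {suc n} f r = f zero ++ rows (f ∘ suc) r

  -- The padding follows the last row, where no address leads, and only lengthens the description.
  program : Program
  program = rows rowAt (replicate padding inc)

  skip-pushes : ∀ n w c → skipRow n (List.map push w ++ c) ≡ skipRow n c
  skip-pushes n []      c = refl
  skip-pushes n (_ ∷ w) c = skip-pushes n w c

  skip-incs : ∀ n j c → skipRow n (replicate j inc ++ c) ≡ skipRow n c
  skip-incs n zero    c = refl
  skip-incs n (suc j) c = skip-incs n j c

  skip-tokens : ∀ n x c → skipRow n (tokens x ++ c) ≡ skip n c
  skip-tokens n (inj₁ (p , w)) c = begin
    skipRow n ((List.map push (codes w) ++ replicate (address p) inc ++ row ∷ []) ++ c)
      ≡⟨ cong (skipRow n) (List.++-assoc (List.map push (codes w)) _ c) ⟩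
    skipRow n (List.map push (codes w) ++ (replicate (address p) inc ++ row ∷ []) ++ c)
      ≡⟨ skip-pushes n (codes w) _ ⟩
    skipRow n ((replicate (address p) inc ++ row ∷ []) ++ c)
      ≡⟨ cong (skipRow n) (List.++-assoc (replicate (address p) inc) (row ∷ []) c) ⟩
    skipRow n (replicate (address p) inc ++ row ∷ c)
      ≡⟨ skip-incs n (address p) (row ∷ c) ⟩
    skip n c ∎
    where open ≡-Reasoning
  skip-tokens n (inj₂ b) c = refl

  skip-rows : ∀ {n} (f : Fin n → (P × List Γ) ⊎ Bool) r i →
    ∃[ c ] skip (toℕ i) (rows (tokens ∘ f) r) ≡ just (tokens (f i) ++ c)
  skip-rows f r zero    = _ , refl
  skip-rows f r (suc i) =
    let c , e = skip-rows (f ∘ suc) r i in c , trans (skip-tokens (toℕ i) (f zero) _) e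

  pop-code : ∀ n γ q → pop n (code γ ++ q) ≡ just (n + toℕ (index FΓ γ) , q)
  pop-code n γ q = go n (toℕ (index FΓ γ))
    where
    go : ∀ n j → pop n ((replicate j true ++ false ∷ []) ++ q) ≡ just (n + j , q)
    go n zero    = cong (λ n → just (n , q)) (sym (+-identityʳ n))
    go n (suc j) = trans (go (suc n) j) (cong (λ n → just (n , q)) (sym (+-suc n j)))

  exec-tokens : ∀ p w c q → exec (tokens (inj₁ (p , w)) ++ c) q 0 ≡ inj₂ (address p , q ++ codes w)
  exec-tokens p w c q = begin
    exec ((List.map push (codes w) ++ replicate (address p) inc ++ row ∷ []) ++ c) q 0
      ≡⟨ cong (λ t → exec t q 0) (List.++-assoc (List.map push (codes w)) _ c) ⟩
    exec (List.map push (codes w) ++ (replicate (address p) inc ++ row ∷ []) ++ c) q 0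
      ≡⟨ pushes (codes w) q ⟩
    exec ((replicate (address p) inc ++ row ∷ []) ++ c) (q ++ codes w) 0
      ≡⟨ cong (λ t → exec t (q ++ codes w) 0) (List.++-assoc (replicate (address p) inc) (row ∷ []) c) ⟩
    exec (replicate (address p) inc ++ row ∷ c) (q ++ codes w) 0
      ≡⟨ incs (address p) 0 ⟩
    inj₂ (address p + 0 , q ++ codes w)
      ≡⟨ cong (λ n → inj₂ (n , q ++ codes w)) (+-identityʳ (address p)) ⟩
    inj₂ (address p , q ++ codes w) ∎
    where
    open ≡-Reasoning
    pushes : ∀ u q {t} → exec (List.map push u ++ t) q 0 ≡ exec t (q ++ u) 0
    pushes []      q {t} = cong (λ q → exec t q 0) (sym (List.++-identityʳ q))
    pushes (b ∷ u) q {t} = trans (pushes u (q ++ b ∷ [])) (cong (λ q → exec t q 0) (List.++-assoc q (b ∷ []) u))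
    incs : ∀ j n {q : List Bool} {t} → exec (replicate j inc ++ row ∷ t) q n ≡ inj₂ (j + n , q)
    incs zero    n = refl
    incs (suc j) n {q} = trans (incs j (suc n)) (cong (λ n → inj₂ (n , q)) (+-suc j n))

  round : ∀ p γ q → ∃[ c ] dispatch program (pop (address p) (codes (γ ∷ q))) ≡ exec (tokens (δ p γ) ++ c) (codes q) 0
  round p γ q
    with c , e ← skip-rows (λ i → let p , γ = Fin.remQuot {size FP} K i in δ (element FP p) (element FΓ γ)) (replicate padding inc) (Fin.combine (index FP p) (index FΓ γ))
    = c , (begin
      dispatch program (pop (address p) (code γ ++ codes q))
        ≡⟨ cong (dispatch program) (pop-code (address p) γ (codes q)) ⟩
      runRow (skip (address p + toℕ (index FΓ γ)) program) (codes q)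
        ≡⟨ cong (λ n → runRow (skip n program) (codes q)) (Fin.toℕ-combine (index FP p) (index FΓ γ)) ⟨
      runRow (skip (toℕ (Fin.combine (index FP p) (index FΓ γ))) program) (codes q)
        ≡⟨ cong (λ m → runRow m (codes q)) e ⟩
      exec (rowAt (Fin.combine (index FP p) (index FΓ γ)) ++ c) (codes q) 0
        ≡⟨ cong (λ (p , γ) → exec (tokens (δ (element FP p) (element FΓ γ)) ++ c) (codes q) 0) (Fin.remQuot-combine (index FP p) (index FΓ γ)) ⟩
      exec (tokens (δ (element FP (index FP p)) (element FΓ (index FΓ γ))) ++ c) (codes q) 0
        ≡⟨ cong₂ (λ p γ → exec (tokens (δ p γ) ++ c) (codes q) 0) (element-index FP p) (element-index FΓ γ) ⟩
      exec (tokens (δ p γ) ++ c) (codes q) 0 ∎)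
    where open ≡-Reasoning

  eval-program : ∀ {p q n b} f → QHalts p q n b → n ≤ f → eval program f (address p) (codes q) ≡ b
  eval-program {p} (suc f) (qstop {γ = γ} {q = q} {b = b} e) (s≤s le) with c , e′ ← round p γ q =
    cong (continue program f) (trans e′ (cong (λ x → exec (tokens x ++ c) (codes q) 0) e))
  eval-program {p} (suc f) (qstep {γ = γ} {q = q} {p′ = p′} {w = w} e h) (s≤s le) with c , e′ ← round p γ q =
    trans (cong (continue program f) (trans e′ (trans (cong (λ x → exec (tokens x ++ c) (codes q) 0) e) (exec-tokens p′ w c (codes q)))))
      (trans (cong (eval program f (address p′)) (sym (codes-++ q w))) (eval-program f h le))

-- Descriptions of programs as words

bits : Token → Word
bits (push b)  = false ∷ false ∷ b ∷ []
bits inc       = false ∷ true ∷ false ∷ []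
bits row       = false ∷ true ∷ true ∷ []
bits (reply b) = true ∷ false ∷ b ∷ []

describe : Program → Word
describe []      = true ∷ true ∷ true ∷ []
describe (t ∷ p) = bits t ++ describe p

parse-describe : ∀ p x → parse (describe p ++ x) ≡ just (p , x)
parse-describe []            x = refl
parse-describe (push b ∷ p)  x rewrite parse-describe p x = refl
parse-describe (inc ∷ p)     x rewrite parse-describe p x = refl
parse-describe (row ∷ p)     x rewrite parse-describe p x = refl
parse-describe (reply b ∷ p) x rewrite parse-describe p x = refl

length-describe : ∀ p → length p ≤ length (describe p)
length-describe []            = z≤n
length-describe (push b ∷ p)  = s≤s (≤-trans (length-describe p) (m≤n+m _ 2))
length-describe (inc ∷ p)     = s≤s (≤-trans (length-describe p) (m≤n+m _ 2))
length-describe (row ∷ p)     = s≤s (≤-trans (length-describe p) (m≤n+m _ 2))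
length-describe (reply b ∷ p) = s≤s (≤-trans (length-describe p) (m≤n+m _ 2))

-- Polynomial bounds

n<2^n : ∀ n → suc n ≤ 2 ^ n
n<2^n zero    = ≤-refl
n<2^n (suc n) =
  +-mono-≤ (≤-trans (s≤s z≤n) (n<2^n n)) (≤-trans (n<2^n n) (≤-reflexive (sym (+-identityʳ _))))

-- With base `2 + n` a single power absorbs constants for all n, and a sum costs just one further
-- factor.
Poly : (ℕ → ℕ) → Set
Poly f = ∃[ c ] (∀ n → f n ≤ (2 + n) ^ c)

poly-const : ∀ d → Poly (λ _ → d)
poly-const d = d , λ n → ≤-trans (≤-trans (n≤1+n d) (n<2^n d)) (^-monoˡ-≤ d (m≤m+n 2 n))

poly-id : Poly (λ n → n)
poly-id = 1 , λ n → ≤-trans (m≤n+m n 2) (≤-reflexive (sym (*-identityʳ (2 + n))))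

poly-* : ∀ {f g} → Poly f → Poly g → Poly (λ n → f n * g n)
poly-* (c , f≤) (d , g≤) = c + d , λ n → ≤-trans (*-mono-≤ (f≤ n) (g≤ n)) (≤-reflexive (sym (^-distribˡ-+-* (2 + n) c d)))

poly-+ : ∀ {f g} → Poly f → Poly g → Poly (λ n → f n + g n)
poly-+ (c , f≤) (d , g≤) = suc (c + d) , λ n → ≤-trans
  (+-mono-≤ (≤-trans (f≤ n) (^-monoʳ-≤ (2 + n) (m≤m+n c d))) (≤-trans (g≤ n) (^-monoʳ-≤ (2 + n) (m≤n+m d c))))
  (≤-trans (≤-reflexive (cong ((2 + n) ^ (c + d) +_) (sym (+-identityʳ _)))) (*-monoˡ-≤ ((2 + n) ^ (c + d)) (m≤m+n 2 n)))

poly-^ : ∀ {f} → Poly f → ∀ c → Poly (λ n → f n ^ c)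
poly-^ F zero    = poly-const 1
poly-^ F (suc c) = poly-* F (poly-^ F c)

-- From n = 2 on, 2 + n ≤ n ^ 2 turns the bound into n ^ (2c). For n = 0 and n = 1 the summand takes
-- over, since (2 + n) ^ c ≤ 3 ^ c.
poly⇒power : ∀ {f} → Poly f → ∃[ c ] (∀ n → f n ≤ n ^ c + c)
poly⇒power {f} (c , f≤) = 2 * c + 3 ^ c , bound
  where
  bound : ∀ n → f n ≤ n ^ (2 * c + 3 ^ c) + (2 * c + 3 ^ c)
  bound zero          = ≤-trans (f≤ 0) (≤-trans (^-monoˡ-≤ c (n≤1+n 2)) (≤-trans (m≤n+m (3 ^ c) (2 * c)) (m≤n+m _ (0 ^ (2 * c + 3 ^ c)))))
  bound (suc zero)    = ≤-trans (f≤ 1) (≤-trans (m≤n+m (3 ^ c) (2 * c)) (m≤n+m _ (1 ^ (2 * c + 3 ^ c))))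
  bound n@(suc (suc m)) = ≤-trans (f≤ n) (≤-trans (^-monoˡ-≤ c n+2≤n²)
    (≤-trans (≤-reflexive (^-*-assoc n 2 c)) (≤-trans (^-monoʳ-≤ n (m≤m+n (2 * c) (3 ^ c))) (m≤m+n _ (2 * c + 3 ^ c)))))
    where
    n+2≤n² : 2 + n ≤ n ^ 2
    n+2≤n² = ≤-slack (m * m + 3 * m) (arith m)
      where
      arith : ∀ m → 2 + suc (suc m) + (m * m + 3 * m) ≡ suc (suc m) * (suc (suc m) * 1)
      arith = solve-∀

-- Writing n = (1 + c) q + r, the claim reduces to a linear function of q being below 2 ^ q.
poly<exp : ∀ {f} → Poly f → ∃[ N ] (∀ n → N ≤ n → suc (f n) ≤ 2 ^ n)
poly<exp {f} (c , f≤) = suc c * M , bound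
  where
  -- Twice c + 4, so that at q = M the claim (c + 4)(q + 1) ≤ 2 ^ q splits into a bound by 2 ^ (c +
  -- 4) for each factor. From there on both sides grow suitably: the right one doubles.
  M : ℕ
  M = 2 * (c + 4)
  linear : ∀ j → (c + 4) * (M + j + 1) ≤ 2 ^ (M + j)
  linear zero = begin
    (c + 4) * (M + 0 + 1)     ≡⟨ cong (λ i → (c + 4) * (i + 1)) (+-identityʳ M) ⟩
    (c + 4) * (M + 1)         ≤⟨ *-mono-≤ (≤-trans (n≤1+n _) (n<2^n (c + 4))) M+1≤ ⟩
    2 ^ (c + 4) * 2 ^ (c + 4) ≡⟨ ^-distribˡ-+-* 2 (c + 4) (c + 4) ⟨
    2 ^ (c + 4 + (c + 4))     ≡⟨ cong (2 ^_) (arith (c + 4)) ⟩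
    2 ^ (M + 0)               ∎
    where
    open ≤-Reasoning
    arith : ∀ x → x + x ≡ 2 * x + 0
    arith = solve-∀
    arith₂ : ∀ c → 2 * (c + 4) + 1 + (2 * c + 7) ≡ 2 * (2 * (c + 4))
    arith₂ = solve-∀
    M+1≤ : M + 1 ≤ 2 ^ (c + 4)
    M+1≤ = subst (λ e → M + 1 ≤ 2 ^ e) (+-comm 4 c) (begin
      M + 1                   ≤⟨ ≤-slack (2 * c + 7) (arith₂ c) ⟩
      2 * (2 * (c + 4))       ≤⟨ *-monoʳ-≤ 2 (*-monoʳ-≤ 2 (≤-trans (≤-reflexive (+-comm c 4)) (≤-slack (3 * c) (arith₃ c)))) ⟩
      2 * (2 * (4 * suc c))   ≤⟨ *-monoʳ-≤ 2 (*-monoʳ-≤ 2 (*-monoʳ-≤ 4 (n<2^n c))) ⟩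
      2 * (2 * (4 * 2 ^ c))   ≡⟨ arith₄ (2 ^ c) ⟩
      2 ^ (4 + c)             ∎)
      where
      arith₃ : ∀ c → 4 + c + 3 * c ≡ 4 * suc c
      arith₃ = solve-∀
      arith₄ : ∀ e → 2 * (2 * (4 * e)) ≡ 2 * (2 * (2 * (2 * e)))
      arith₄ = solve-∀
  linear (suc j) = begin
    (c + 4) * (M + suc j + 1)       ≤⟨ ≤-slack ((c + 4) * (M + j)) (arith (c + 4) M j) ⟩
    2 * ((c + 4) * (M + j + 1))     ≤⟨ *-monoʳ-≤ 2 (linear j) ⟩
    2 ^ suc (M + j)                 ≡⟨ cong (2 ^_) (+-suc M j) ⟨
    2 ^ (M + suc j)                 ∎
    where
    open ≤-Reasoning
    arith : ∀ a m j → a * (m + suc j + 1) + a * (m + j) ≡ 2 * (a * (m + j + 1))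
    arith = solve-∀
  linear′ : ∀ q → M ≤ q → (c + 4) * (q + 1) ≤ 2 ^ q
  linear′ q M≤q = subst (λ q → (c + 4) * (q + 1) ≤ 2 ^ q) (m+[n∸m]≡n M≤q) (linear (q ∸ M))
  bound : ∀ n → suc c * M ≤ n → suc (f n) ≤ 2 ^ n
  bound n N≤n = begin
    suc (f n)              ≤⟨ s≤s (f≤ n) ⟩
    -- The successor is absorbed by one more factor 2 + n; this is why n is divided by 1 + c and not
    -- by c.
    suc ((2 + n) ^ c)      ≤⟨ +-mono-≤ {1} {(2 + n) ^ c} {(2 + n) ^ c} {(2 + n) ^ c + 0} (m^n>0 (2 + n) c) (≤-reflexive (sym (+-identityʳ _))) ⟩
    2 * (2 + n) ^ c        ≤⟨ *-monoˡ-≤ ((2 + n) ^ c) (m≤m+n 2 n) ⟩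
    (2 + n) ^ suc c        ≤⟨ ^-monoˡ-≤ (suc c) n+2≤ ⟩
    (2 ^ q) ^ suc c        ≡⟨ ^-*-assoc 2 q (suc c) ⟩
    2 ^ (q * suc c)        ≤⟨ ^-monoʳ-≤ 2 (m/n*n≤m n (suc c)) ⟩
    2 ^ n                  ∎
    where
    open ≤-Reasoning
    q r : ℕ
    q = n / suc c
    r = n % suc c
    M≤q : M ≤ q
    M≤q = ≤-trans (≤-reflexive (sym (m*n/n≡m M (suc c)))) (/-monoˡ-≤ (suc c) (≤-trans (≤-reflexive (*-comm M (suc c))) N≤n))
    n+2≤ : 2 + n ≤ 2 ^ q
    n+2≤ = begin
      2 + n                        ≡⟨ cong (2 +_) (m≡m%n+[m/n]*n n (suc c)) ⟩
      2 + (r + q * suc c)          ≤⟨ +-monoʳ-≤ 2 (+-monoˡ-≤ (q * suc c) (<⇒≤ (m%n<n n (suc c)))) ⟩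
      2 + (suc c + q * suc c)      ≤⟨ ≤-slack (3 * q + 1) (arith c q) ⟩
      (c + 4) * (q + 1)            ≤⟨ linear′ q M≤q ⟩
      2 ^ q                        ∎
      where
      arith : ∀ c q → 2 + (suc c + q * suc c) + (3 * q + 1) ≡ (c + 4) * (q + 1)
      arith = solve-∀

-- Since n ≤ 2 ^ n, each term is at most a multiple of (2 ^ n) ^ 3, and the multiples add up to 88 ≤
-- 2 ^ 7. As an exponent, 10 gives 3n ≤ n ^ 10 for n ≥ 2; as a summand it settles n = 0 and n = 1.
universal-exponential : ∃[ c ] (∀ n → universalTime n ≤ 2 ^ (n ^ c + c))
universal-exponential = 10 , λ n → ≤-trans (cubic n) (^-monoʳ-≤ 2 (exponent n))
  where
  cubic : ∀ n → universalTime n ≤ 2 ^ (3 * n + 7)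
  cubic n = begin
    n * 7 + 15 + E * (n * 6 + (n * 4 + 8 + E * n) * 4 + 8)
      ≤⟨ +-mono-≤ (+-mono-≤ (*-monoˡ-≤ 7 n≤E) (*-monoʳ-≤ 15 1≤E)) (*-monoʳ-≤ E (+-mono-≤ (+-mono-≤ (*-monoˡ-≤ 6 n≤E)
           (*-monoˡ-≤ 4 (+-mono-≤ (+-mono-≤ (*-monoˡ-≤ 4 n≤E) (*-monoʳ-≤ 8 1≤E)) (*-monoʳ-≤ E n≤E)))) (*-monoʳ-≤ 8 1≤E))) ⟩
    E * 7 + 15 * E + E * (E * 6 + (E * 4 + 8 * E + E * E) * 4 + 8 * E)
      ≡⟨ arith E ⟩
    22 * E + 62 * (E * E) + 4 * (E * (E * E))
      ≤⟨ +-monoˡ-≤ (4 * (E * (E * E))) (+-mono-≤ (*-monoʳ-≤ 22 (≤-trans E≤E² E²≤E³)) (*-monoʳ-≤ 62 E²≤E³)) ⟩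
    22 * (E * (E * E)) + 62 * (E * (E * E)) + 4 * (E * (E * E))
      ≤⟨ ≤-slack (40 * (E * (E * E))) (arith₂ (E * (E * E))) ⟩
    128 * (E * (E * E))
      ≡⟨ cong (128 *_) (trans (cong (E *_) (sym (^-distribˡ-+-* 2 n n))) (sym (^-distribˡ-+-* 2 n (n + n)))) ⟩
    2 ^ 7 * 2 ^ (n + (n + n))
      ≡⟨ ^-distribˡ-+-* 2 7 (n + (n + n)) ⟨
    2 ^ (7 + (n + (n + n)))
      ≡⟨ cong (2 ^_) (arith₃ n) ⟩
    2 ^ (3 * n + 7) ∎
    where
    open ≤-Reasoning
    E : ℕ
    E = 2 ^ n
    n≤E : n ≤ E
    n≤E = ≤-trans (n≤1+n n) (n<2^n n)
    1≤E : 1 ≤ E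
    1≤E = m^n>0 2 n
    E≤E² : E ≤ E * E
    E≤E² = ≤-trans (≤-reflexive (sym (*-identityʳ E))) (*-monoʳ-≤ E 1≤E)
    E²≤E³ : E * E ≤ E * (E * E)
    E²≤E³ = *-monoʳ-≤ E E≤E²
    arith : ∀ e → e * 7 + 15 * e + e * (e * 6 + (e * 4 + 8 * e + e * e) * 4 + 8 * e) ≡ 22 * e + 62 * (e * e) + 4 * (e * (e * e))
    arith = solve-∀
    arith₂ : ∀ e → 22 * e + 62 * e + 4 * e + 40 * e ≡ 128 * e
    arith₂ = solve-∀
    arith₃ : ∀ n → 7 + (n + (n + n)) ≡ 3 * n + 7
    arith₃ = solve-∀
  exponent : ∀ n → 3 * n + 7 ≤ n ^ 10 + 10
  exponent zero            = m≤m+n 7 3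
  exponent (suc zero)      = m≤m+n 10 1
  exponent n@(suc (suc m)) = +-mono-≤ (≤-trans (≤-reflexive (*-comm 3 n)) (*-monoʳ-≤ n (≤-trans (m≤m+n 3 509) (^-monoˡ-≤ 9 {2} {n} (s≤s (s≤s z≤n)))))) (m≤m+n 7 3)

-- The prelude writes c₀ ∷ cs ++ x, from its end, on the input tape of M.
module Autoreduction (M : OracleTM) (c₀ : Bool) (cs : Word) where

  open Interception M using (Control; finite-Control; simulate) renaming (kind to interceptKind)

  private
    e m : ℕ
    e = OracleTM.extraTapes M
    m = OracleTM.auxSymbols M

  data Prelude : Set where
    toEnd back toEnd′ : Prelude
    writing           : Fin (suc (length cs)) → Prelude

  finite-Prelude : Finite Prelude
  finite-Prelude = retract
    (λ { toEnd → inj₁ (Fin.# 0) ; back → inj₁ (Fin.# 1) ; toEnd′ → inj₁ (Fin.# 2) ; (writing i) → inj₂ i })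
    (λ { (inj₁ zero) → toEnd ; (inj₁ (suc zero)) → back ; (inj₁ (suc (suc zero))) → toEnd′ ; (inj₂ i) → writing i })
    (λ { toEnd → refl ; back → refl ; toEnd′ → refl ; (writing i) → refl })
    (finite-Fin 3 finite-⊎ finite-Fin (suc (length cs)))

  State : Set
  State = Prelude ⊎ Control

  Action : Set
  Action = Symbol m × Direction

  control₃ : (Symbol m → Symbol m → Symbol m → State × Action × Action × Action) → Kind (3 + e) m State
  control₃ f = ordinary λ { (x ∷ w ∷ z ∷ v) →
    let s , a , b , c = f x w z in s , a ∷ b ∷ c ∷ Vec.map (_, stay) v , nothing }

  launch : Control
  launch = running , OracleTM.start M , false , false , false

  -- Writing x and then the word from right to left leaves the third tape exactly as `inputTape`,
  -- with the head on the first bit. The index in `writing i` is the number of bits of `cs` still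
  -- missing.
  preludeKind : Prelude → Kind (3 + e) m State
  preludeKind toEnd = control₃ λ
    { (bit b) w z → inj₁ toEnd , (bit b , right) , (w , stay) , (z , stay)
    ; x       w z → inj₁ back , (x , left) , (w , right) , (z , stay) }
  preludeKind back = control₃ λ
    { (bit b) w z → inj₁ back , (bit b , left) , (w , stay) , (bit b , left)
    ; x       w z → inj₁ (writing (Fin.fromℕ (length cs))) , (x , right) , (w , stay) , (z , stay) }
  preludeKind (writing zero) = control₃ λ x w z →
    inj₁ toEnd′ , (x , stay) , (w , stay) , (bit c₀ , stay)
  preludeKind (writing (suc i)) = control₃ λ x w z →
    inj₁ (writing (Fin.inject₁ i)) , (x , stay) , (w , stay) , (bit (List.lookup cs i) , left)
  preludeKind toEnd′ = control₃ λ
    { (bit b) w z → inj₁ toEnd′ , (bit b , right) , (w , stay) , (z , stay)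
    ; x       w z → inj₂ launch , (x , stay) , (w , stay) , (z , stay) }

  kind : State → Kind (3 + e) m State
  kind (inj₁ p) = preludeKind p
  kind (inj₂ s) = mapKind inj₂ (interceptKind nothing s)

  module _ (B : Language) where

    private
      module X = Cursor {m = m} bit []

    hop₃ : ∀ {c s X₁ W₁ Z₁ X₂ W₂ Z₂ t qs d} {ts : Vec (Tape m) e} →
      outcome kind c ≡ goto (conf s (X₁ ∷ W₁ ∷ Z₁ ∷ Vec.zipWith writeMove (Vec.map (_, stay) (Vec.map scanned ts)) ts) []) →
      X₁ ≡ X₂ → W₁ ≡ W₂ → Z₁ ≡ Z₂ → Reach kind B (conf s (X₂ ∷ W₂ ∷ Z₂ ∷ ts) []) t qs d → Reach kind B c (suc t) qs d
    hop₃ {ts = ts} eq refl refl refl r =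
      move eq (subst (λ ts → Reach kind B (conf _ (_ ∷ _ ∷ _ ∷ ts) []) _ _ _) (sym (idle ts)) r)

    Move : Prelude → Tape m → Tape m → Tape m → ℕ → State → Tape m → Tape m → Tape m → Set
    Move p X W Z t s X′ W′ Z′ = ∀ {ts : Vec (Tape m) e} →
      Reach kind B (conf (inj₁ p) (X ∷ W ∷ Z ∷ ts) []) t [] (conf s (X′ ∷ W′ ∷ Z′ ∷ ts) [])

    go-to-end : ∀ {u′} u r → r ʳ++ u ≡ u′ →
      Move toEnd (reading u r) blankTape blankTape (suc (length r)) (inj₁ back) (backing u′ []) (X.cursor [] []) blankTape
    go-to-end u []      refl = hop₃ refl (reading-end u) refl refl arrived
    go-to-end u (b ∷ r) eq   = hop₃ refl (reading-right u b r) refl refl (go-to-end (b ∷ u) r eq)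

    copy-back : ∀ {W x} u r → u ʳ++ r ≡ x →
      Move back (backing u r) W (tape [] blank ⌜ r ⌝) (suc (length u))
           (inj₁ (writing (Fin.fromℕ (length cs)))) (X.cursor [] x) W (tape [] blank ⌜ x ⌝)
    copy-back []      r refl = hop₃ refl (X.leftOf-right [] r) refl refl arrived
    copy-back (b ∷ u) r eq   = hop₃ refl (backing-left b u r) refl refl (copy-back u (b ∷ r) eq)

    write-code : ∀ {X W y} n i z → toℕ i ≡ n → List.take (suc n) (c₀ ∷ cs) ++ z ≡ y →
      Move (writing i) X W (tape [] blank ⌜ z ⌝) (suc n) (inj₁ toEnd′) X W (inputTape y)
    write-code zero    zero    z _ refl = hop₃ refl refl refl refl arrived
    write-code (suc n) (suc i) z i≡n eq =
      hop₃ refl refl refl refl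
        (write-code n (Fin.inject₁ i) (List.lookup cs i ∷ z) (trans (Fin.toℕ-inject₁ i) (suc-injective i≡n))
          (trans (cong (c₀ ∷_) (trans (sym (List.++-assoc (List.take n cs) (List.lookup cs i ∷ []) z))
                                      (cong (_++ z) (sym taken)))) eq))
      where
      taken : List.take (suc n) cs ≡ List.take n cs ++ List.lookup cs i ∷ []
      taken = subst (λ n → List.take (suc n) cs ≡ List.take n cs ++ List.lookup cs i ∷ []) (suc-injective i≡n) (List.take-suc cs i)

    return-to-end : ∀ {W Z u′} u r → r ʳ++ u ≡ u′ →
      Move toEnd′ (X.cursor u r) W Z (suc (length r)) (inj₂ launch) (X.cursor u′ []) W Z
    return-to-end u []      refl = hop₃ refl refl refl refl arrived
    return-to-end u (b ∷ r) eq   = hop₃ refl (X.cursor-right u b r) refl refl (return-to-end (b ∷ u) r eq)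

    from : ∀ {p X₁ X W Z t s X′ W′ Z′} → X₁ ≡ X → Move p X₁ W Z t s X′ W′ Z′ → Move p X W Z t s X′ W′ Z′
    from refl r = r

    prelude : ∀ x → Move toEnd (inputTape x) blankTape blankTape (length x * 3 + length cs + 4)
                         (inj₂ launch) (X.cursor (reverse x) []) (X.cursor [] []) (inputTape (c₀ ∷ cs ++ x))
    prelude x = from (reading-input x) (relax bound
        (go-to-end [] x refl ▷
         copy-back (reverse x) [] (List.reverse-involutive x) ▷
         write-code (length cs) (Fin.fromℕ (length cs)) x (Fin.toℕ-fromℕ (length cs))
           (cong (λ w → c₀ ∷ w ++ x) (List.take-all (length cs) cs ≤-refl)) ▷
         return-to-end [] x refl))
      where
      bound : suc (length x) + (suc (length (reverse x)) + (suc (length cs) + suc (length x))) ≤ length x * 3 + length cs + 4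
      bound = ≤-reflexive (trans (cong (λ r → suc (length x) + (suc r + (suc (length cs) + suc (length x)))) (List.length-reverse x))
                                 (arith (length x) (length cs)))
        where
        arith : ∀ a b → suc a + (suc a + (suc b + suc a)) ≡ a * 3 + b + 4
        arith = solve-∀

  reduction : OracleTM
  reduction = machine (finite-Prelude finite-⊎ finite-Control) (inj₁ toEnd) kind

  reduction-run : ∀ {B x t qs b} → RunOn M (answer nothing B x) (c₀ ∷ cs ++ x) t qs b →
    ∃[ t′ ] (RunOn reduction B x t′ (forwarded nothing x qs) (verdict nothing (flagged x false qs) (lastAnswer nothing B x false qs) b)
             × t′ ≤ length x * 3 + length cs + 4 + t * (length x * 2 + t * 2 + 6))
  reduction-run {B} {x} {t} run =
    machine-run (finite-Prelude finite-⊎ finite-Control) (inj₁ toEnd) kind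
      (prelude B x ▷ʰ map-halts inj₂ (λ _ → refl) (simulate B x [] nothing t run refl refl ≤-refl))

-- What is forwarded and what the flag tells

forwarded-constant : ∀ a x qs → forwarded (just a) x qs ≡ []
forwarded-constant a x []       = refl
forwarded-constant a x (_ ∷ qs) = forwarded-constant a x qs

forwarded-≤ : ∀ x qs → length (forwarded nothing x qs) ≤ length qs
forwarded-≤ x []       = z≤n
forwarded-≤ x (w ∷ qs) with does (w ≟ʷ x)
... | true  = ≤-trans (forwarded-≤ x qs) (n≤1+n _)
... | false = s≤s (forwarded-≤ x qs)

forwarded-∌ : ∀ x qs → x ∉ forwarded nothing x qs
forwarded-∌ x (w ∷ qs) x∈ with w ≟ʷ x
... | yes _ = forwarded-∌ x qs x∈
forwarded-∌ x (w ∷ qs) (here x≡w) | no w≢x = w≢x (sym x≡w)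
forwarded-∌ x (w ∷ qs) (there x∈) | no _   = forwarded-∌ x qs x∈

flagged-true : ∀ x qs → flagged x true qs ≡ true
flagged-true x []       = refl
flagged-true x (w ∷ qs) with does (w ≟ʷ x)
... | true  = flagged-true x qs
... | false = flagged-true x qs

answer-other : ∀ {B x w} → ¬ w ≡ x → answer nothing B x w ≡ B w
answer-other {x = x} {w} w≢x with w ≟ʷ x
... | yes w≡x = ⊥-elim (w≢x w≡x)
... | no _    = refl

unflagged : ∀ B x qs → flagged x false qs ≡ false → All (λ w → answer nothing B x w ≡ B w) qs
unflagged B x []       e = []
unflagged B x (w ∷ qs) e with w ≟ʷ x
... | yes _ with () ← trans (sym e) (flagged-true x qs)
... | no w≢x = answer-other {B} w≢x ∷ unflagged B x qs e

-- If x is queried, any other query has the answer that is remembered as the last one.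
flagged-constant : ∀ B x qs → length qs ≤ 2 → flagged x false qs ≡ true →
  lastAnswer nothing B x false qs ≡ B x → All (λ w → B w ≡ B x) qs
flagged-constant B x (u ∷ []) le fl la with u ≟ʷ x
... | yes refl = refl ∷ []
flagged-constant B x (u ∷ v ∷ []) le fl la with u ≟ʷ x | v ≟ʷ x
... | yes refl | yes refl = refl ∷ refl ∷ []
... | yes refl | no _     = refl ∷ la ∷ []
... | no _     | yes refl = la ∷ refl ∷ []
flagged-constant B x (u ∷ v ∷ w ∷ qs) (s≤s (s≤s ())) fl la

≢⇒not≡ : ∀ {a b} → ¬ a ≡ b → not a ≡ b
≢⇒not≡ {true}  {true}  a≢b = ⊥-elim (a≢b refl)
≢⇒not≡ {true}  {false} a≢b = refl
≢⇒not≡ {false} {true}  a≢b = refl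
≢⇒not≡ {false} {false} a≢b = ⊥-elim (a≢b refl)

not-fixed : ∀ {b} → ¬ b ≡ not b
not-fixed {true}  ()
not-fixed {false} ()

describe-nonempty : ∀ p → ∃[ b ] ∃[ w ] describe p ≡ b ∷ w
describe-nonempty []            = _ , _ , refl
describe-nonempty (push b ∷ p)  = _ , _ , refl
describe-nonempty (inc ∷ p)     = _ , _ , refl
describe-nonempty (row ∷ p)     = _ , _ , refl
describe-nonempty (reply b ∷ p) = _ , _ , refl

diagonal-parsed : ∀ B z {p x v} → parse z ≡ just (p , x) →
  eval p (rem (clock z)) 0 (initialQueue x z (B x)) ≡ v → diagonal B z ≡ v
diagonal-parsed B z e e′ = trans (cong (interpret B z) e) e′

-- The value of the diagonal set at the padded word

module Diagonalization (M : OracleTM) (c : ℕ) (time : RunsInTime M (λ n → n ^ c + c)) where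

  open Interception M using (Control; finite-Control; simulate) renaming (kind to interceptKind)

  private
    e m : ℕ
    e = OracleTM.extraTapes M
    m = OracleTM.auxSymbols M

  s₀ : Control
  s₀ = running , OracleTM.start M , false , false , false

  open TapeQueue {e} {m} s₀ (λ a → interceptKind (just a))

  -- `tapeTime` is the bound of `simulate` with the time of M for both t and N. In `queueTime`, the
  -- pass over the input is followed by the bound of `simulate-queue`, with Z the initial queue plus
  -- one cell per tape and step.
  tapeTime queueTime : ℕ → ℕ
  tapeTime n = (n ^ c + c) * (n * 2 + (n ^ c + c) * 2 + 6)
  queueTime n = n * 2 + 3 + suc (tapeTime n) * ((n * 2 + (9 + e * 2) + tapeTime n * (3 + e)) * 2)

  poly-time : Poly (λ n → n ^ c + c)
  poly-time = poly-+ (poly-^ poly-id c) (poly-const c)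

  poly-2n : Poly (λ n → n * 2)
  poly-2n = poly-* poly-id (poly-const 2)

  poly-tapeTime : Poly tapeTime
  poly-tapeTime = poly-* poly-time (poly-+ (poly-+ poly-2n (poly-* poly-time (poly-const 2))) (poly-const 6))

  poly-queueTime : Poly queueTime
  poly-queueTime = poly-+ (poly-+ poly-2n (poly-const 3)) (poly-* (poly-+ (poly-const 1) poly-tapeTime)
    (poly-* (poly-+ (poly-+ poly-2n (poly-const (9 + e * 2))) (poly-* poly-tapeTime (poly-const (3 + e)))) (poly-const 2)))

  abstract
    padding-bound : ∃[ N ] (∀ n → N ≤ n → suc (queueTime n) ≤ 2 ^ n)
    padding-bound = poly<exp poly-queueTime

  -- No circularity: `queueTime` depends on the number of tapes and the time bound of M, not on the
  -- program, and is measured in the length of the whole padded word.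
  padding : ℕ
  padding = proj₁ padding-bound

  module E = Encoding (finite-Phase (3 + e) m finite-Control) (finite-Glyph m) δ padding

  queue-halts : ∀ {B a x b z t qs v n} → RunOn M (answer (just a) B x) (b ∷ z) t qs v →
    t ≤ n ^ c + c → length x ≤ n → length (b ∷ z) ≤ n →
    QHalts readX₀ (inputs x (b ∷ z) a) (queueTime n) (if flagged x false qs then not v else a)
  queue-halts {B} {a} {x} {b} {z} {t} {all} {v} {n} run t≤ x≤ z≤ =
    relax-q (+-mono-≤ input≤ (*-monoˡ-≤ (Z * 2) (s≤s T≤)))
      (run-full-pass (initial-pass x b z a)
        (simulate-queue {w = []} {t = t * (length x * 2 + t * 2 + 6)} Z
          (subst (λ qs → Halts (interceptKind (just a)) B (conf s₀ (initialTapes x (b ∷ z)) []) (t * (length x * 2 + t * 2 + 6)) qs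
                           (if flagged x false all then not v else a))
            (forwarded-constant a x all)
            (simulate B x [] (just a) {v = []} t run tt refl ≤-refl))
          (+-mono-≤ queue≤ (*-monoˡ-≤ (3 + e) T≤))))
    where
    Z : ℕ
    Z = n * 2 + (9 + e * 2) + tapeTime n * (3 + e)
    double : ∀ n → n + n ≡ n * 2
    double = solve-∀
    T≤ : t * (length x * 2 + t * 2 + 6) ≤ tapeTime n
    T≤ = *-mono-≤ t≤ (+-monoˡ-≤ 6 (+-mono-≤ (*-monoˡ-≤ 2 x≤) (*-monoˡ-≤ 2 t≤)))
    input≤ : length (inputs x (b ∷ z) a) ≤ n * 2 + 3
    input≤ = ≤-trans (≤-reflexive (length-inputs x (b ∷ z) a))
      (+-monoˡ-≤ 3 (≤-trans (+-mono-≤ x≤ z≤) (≤-reflexive (double n))))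
    queue≤ : length (queue a (initialTapes x (b ∷ z))) ≤ n * 2 + (9 + e * 2)
    queue≤ = ≤-trans (≤-reflexive (length-queue x b z a))
      (+-monoˡ-≤ (9 + e * 2) (≤-trans (+-mono-≤ x≤ (≤-trans (n≤1+n _) z≤)) (≤-reflexive (double n))))

  codes-initial : ∀ x z a → E.codes (inputs x z a) ≡ initialQueue x z a
  codes-initial x z a = trans (E.codes-++ (List.map input x) _) (cong₂ (λ u v → u ++ separator ++ v) (codes-input x)
    (trans (E.codes-++ (List.map input z) _) (cong₂ (λ u v → u ++ separator ++ v) (codes-input z) (codes-input (a ∷ [])))))
    where
    codes-input : ∀ w → E.codes (List.map input w) ≡ encode w
    codes-input []          = refl
    codes-input (false ∷ w) = cong (false ∷_) (codes-input w)
    codes-input (true ∷ w)  = cong (λ l → true ∷ false ∷ l) (codes-input w)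

  padding≤ : padding ≤ length E.program
  padding≤ = padded E.rowAt
    where
    padded : ∀ {n} (f : Fin n → Program) → padding ≤ length (E.rows f (replicate padding inc))
    padded {zero}  f = ≤-reflexive (sym (List.length-replicate padding))
    padded {suc n} f = ≤-trans (padded (f ∘ suc)) (≤-trans (m≤n+m _ (length (f zero))) (≤-reflexive (sym (List.length-++ (f zero)))))

  eval-inputs : ∀ {B x b y f t qs v} → RunOn M (λ _ → B x) (b ∷ y) t qs v →
    t ≤ length (b ∷ y) ^ c + c → length x ≤ length (b ∷ y) → queueTime (length (b ∷ y)) ≤ f →
    eval E.program f 0 (initialQueue x (b ∷ y) (B x)) ≡ (if flagged x false qs then not v else B x)
  eval-inputs {B} {x} {b} {y} {f} run t≤ x≤ fuel =
    trans (sym (cong₂ (eval E.program f) address₀ (codes-initial x (b ∷ y) (B x))))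
          (E.eval-program f halts fuel)
    where
    address₀ : E.address readX₀ ≡ 0
    address₀ = *-zeroʳ (size (finite-Glyph m))
    halts : QHalts readX₀ (inputs x (b ∷ y) (B x)) (queueTime (length (b ∷ y))) _
    halts = queue-halts {B} {n = length (b ∷ y)} run t≤ x≤ ≤-refl

  -- Abstract, as conversion checking would otherwise run the interpreter on the word.
  abstract
    c₀ : Bool
    c₀ = proj₁ (describe-nonempty E.program)

    cs : Word
    cs = proj₁ (proj₂ (describe-nonempty E.program))

    parse-word : ∀ x → parse (c₀ ∷ cs ++ x) ≡ just (E.program , x)
    parse-word x = trans (cong (λ w → parse (w ++ x)) (sym (proj₂ (proj₂ (describe-nonempty E.program)))))
                         (parse-describe E.program x)

    padding≤word : padding ≤ length (c₀ ∷ cs)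
    padding≤word = ≤-trans padding≤ (≤-trans (length-describe E.program)
      (≤-reflexive (cong length (proj₂ (proj₂ (describe-nonempty E.program))))))

  -- The clock grants 2 ^ |z| - 1 rounds, which is why `poly<exp` yields a strict inequality.
  enough-fuel : ∀ z → padding ≤ length z → queueTime (length z) ≤ rem (clock z)
  enough-fuel z le = ≤-pred (≤-trans (proj₂ padding-bound (length z) le) (≤-reflexive (sym (rem-clock z))))

  diagonal-value : ∀ B x {t qs v} → RunOn M (λ _ → B x) (c₀ ∷ cs ++ x) t qs v →
    t ≤ length (c₀ ∷ cs ++ x) ^ c + c →
    diagonal B (c₀ ∷ cs ++ x) ≡ (if flagged x false qs then not v else B x)
  diagonal-value B x run t≤ =
    diagonal-parsed B (c₀ ∷ cs ++ x) (parse-word x)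
      (eval-inputs {B} run t≤ (≤-trans (m≤n+m (length x) (length (c₀ ∷ cs))) longer)
        (enough-fuel (c₀ ∷ cs ++ x) (≤-trans padding≤word (≤-trans (m≤m+n _ (length x)) longer))))
    where
    longer : length (c₀ ∷ cs) + length x ≤ length (c₀ ∷ cs ++ x)
    longer = ≤-reflexive (sym (List.length-++ (c₀ ∷ cs)))

-- Here d is the value of the diagonal set at z, and b the verdict when x ∉ A is assumed.
correct-verdict : ∀ {M A x z qs b v d t t′ t″} →
  RunOn M (answer nothing A x) z t qs b → RunOn M (λ _ → A x) z t′ qs v → RunOn M A z t″ qs d →
  d ≡ (if flagged x false qs then not v else A x) → length qs ≤ 2 →
  verdict nothing (flagged x false qs) (lastAnswer nothing A x false qs) b ≡ A x
correct-verdict {A = A} {x} {qs = qs} run run-constant run-A d≡ le with flagged x false qs in fl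
... | false = trans (proj₂ (run-deterministic (run-agree (unflagged A x qs fl) run) run-A)) d≡
... | true  = ≢⇒not≡ λ la → not-fixed (trans
      (proj₂ (run-deterministic
        (run-agree (All.map sym (flagged-constant A x qs le fl la)) run-constant) run-A)) d≡)

-- The autoreduction

module Autoreducible (A : Language) (M : OracleTM) (M-reduces : Is2ttReduction M (diagonal A) A) where

  open Is2ttReduction M-reduces

  private
    c : ℕ
    c = proj₁ polynomialTime

  open Diagonalization M c (proj₂ polynomialTime) using (c₀; cs; diagonal-value)
  open Autoreduction M c₀ cs

  -- Stated for every oracle B, because the time bound, the conditions on queries and nonadaptivity
  -- are demanded for all oracles, correctness only for A.
  reduction-runs : ∀ B x → ∃[ t ] ∃[ qs ] ∃[ b ] (RunOn M (answer nothing B x) (c₀ ∷ cs ++ x) t qs b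
    × (∃[ t′ ] (RunOn reduction B x t′ (forwarded nothing x qs) (verdict nothing (flagged x false qs) (lastAnswer nothing B x false qs) b)
              × t′ ≤ length x * 3 + length cs + 4 + t * (length x * 2 + t * 2 + 6)))
    × t ≤ length (c₀ ∷ cs ++ x) ^ c + c)
  reduction-runs B x =
    let t , qs , b , run , t≤ = proj₂ polynomialTime (answer nothing B x) (c₀ ∷ cs ++ x)
    in t , qs , b , run , reduction-run {x = x} run , t≤

  correct : ∀ x → ∃[ t ] ∃[ qs ] RunOn reduction A x t qs (A x)
  correct x with reduction-runs A x
  ... | t , qs , b , run , (t′ , run′ , _) , _ = t′ , forwarded nothing x qs , subst (RunOn reduction A x t′ _) value run′
    where
    z : Word
    z = c₀ ∷ cs ++ x
    constant : ∃[ t ] ∃[ qs ] ∃[ v ] (RunOn M (λ _ → A x) z t qs v × t ≤ length z ^ c + c)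
    constant = proj₂ polynomialTime (λ _ → A x) z
    v : Bool
    v = proj₁ (proj₂ (proj₂ constant))
    -- By nonadaptivity the constant-answer run has the query list of the intercepted run, so the
    -- flag in the definition of the diagonal set is the flag seen by the reduction.
    run-constant : RunOn M (λ _ → A x) z (proj₁ constant) qs v
    run-constant = let _ , qs′ , _ , r , _ = constant in
      subst (λ qs → RunOn M (λ _ → A x) z (proj₁ constant) qs v) (nonadaptive {x = z} r run) r
    run-A : ∃[ t ] RunOn M A z t qs (diagonal A z)
    run-A = let t , qs′ , r = decides z in t , subst (λ qs → RunOn M A z t qs (diagonal A z)) (nonadaptive {x = z} r run) r
    diagonal-z : diagonal A z ≡ (if flagged x false qs then not v else A x)
    diagonal-z = diagonal-value A x run-constant (proj₂ (proj₂ (proj₂ (proj₂ constant))))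
    value = correct-verdict {z = z} run run-constant (proj₂ run-A) diagonal-z (atMostTwo {x = z} run)

  poly-reduction : ∃[ d ] RunsInTime reduction (λ n → n ^ d + d)
  poly-reduction = proj₁ bounded , λ B x →
    let t , qs , b , run , (t′ , run′ , t′≤) , t≤ = reduction-runs B x
    in t′ , _ , _ , run′ , ≤-trans t′≤ (≤-trans
         (+-monoʳ-≤ (length x * 3 + length cs + 4) (*-mono-≤ (t≤f t≤) (+-monoˡ-≤ 6 (+-monoʳ-≤ (length x * 2) (*-monoˡ-≤ 2 (t≤f t≤))))))
         (proj₂ bounded (length x)))
    where
    -- The prefix of z is fixed along with M, so |z| exceeds |x| by a constant and the bound stays
    -- polynomial in |x|.
    f : ℕ → ℕ
    f n = (suc (length cs) + n) ^ c + c
    t≤f : ∀ {t x} → t ≤ length (c₀ ∷ cs ++ x) ^ c + c → t ≤ f (length x)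
    t≤f {x = x} t≤ = ≤-trans t≤ (≤-reflexive (cong (λ n → suc n ^ c + c) (List.length-++ cs)))
    poly-f : Poly f
    poly-f = poly-+ (poly-^ (poly-+ (poly-const (suc (length cs))) poly-id) c) (poly-const c)
    bounded : ∃[ d ] (∀ n → n * 3 + length cs + 4 + f n * (n * 2 + f n * 2 + 6) ≤ n ^ d + d)
    bounded = poly⇒power (poly-+ (poly-+ (poly-+ (poly-* poly-id (poly-const 3)) (poly-const (length cs))) (poly-const 4))
      (poly-* poly-f (poly-+ (poly-+ (poly-* poly-id (poly-const 2)) (poly-* poly-f (poly-const 2))) (poly-const 6))))

  -- By determinism an arbitrary run is the one constructed above, whose queries are those of M with
  -- x left out.
  queries : QueriesSatisfy reduction λ x qs → length qs ≤ 2 × x ∉ qs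
  queries {B} {x} run with reduction-runs B x
  ... | _ , qs , _ , run₀ , (_ , run′ , _) , _ with refl ← proj₁ (run-deterministic run run′) =
    ≤-trans (forwarded-≤ x qs) (atMostTwo {x = c₀ ∷ cs ++ x} run₀) , forwarded-∌ x qs

  reduction-nonadaptive : Nonadaptive reduction
  reduction-nonadaptive {B} {B′} {x} run run′ with reduction-runs B x | reduction-runs B′ x
  ... | _ , _ , _ , r , (_ , s , _) , _ | _ , _ , _ , r′ , (_ , s′ , _) , _ =
    trans (proj₁ (run-deterministic run s)) (trans (cong (forwarded nothing x) (nonadaptive {x = c₀ ∷ cs ++ x} r r′)) (sym (proj₁ (run-deterministic run′ s′))))

  autoreducible : 2ttAutoreducible A
  autoreducible = reduction , record
    { polynomialTime = poly-reduction
    ; decides        = correct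
    ; nonadaptive    = reduction-nonadaptive
    ; atMostTwo      = λ run → proj₁ (queries run)
    } , λ run → proj₂ (queries run)

theorem4p5 : ∀ {ℓ : Level} (𝒞 : ComplexityClass ℓ) →
    ClosedUnderShorterQueryExpReductions 𝒞 →
    ∀ A → 2ttComplete 𝒞 A → 2ttAutoreducible A
theorem4p5 𝒞 closed A (A∈𝒞 , complete) =
  let M , M-reduces = complete (diagonal A) (closed A (diagonal A) A∈𝒞 universalMachine
        (proj₁ universal-exponential , λ B z → let t , run , t≤ = universal-run B z in
           t , _ , _ , run , ≤-trans t≤ (proj₂ universal-exponential (length z)))
        (λ {B} {z} run → subst (λ qs → length qs ≤ 1) (sym (asked-queries B z run)) (asks≤1 (parse z)))
        (λ {B} {z} run → subst (All (λ w → length w < length z)) (sym (asked-queries B z run)) (parse-shorter z))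
        λ z → let t , run , _ = universal-run A z in t , _ , run)
  in Autoreducible.autoreducible A M M-reduces
  where
  asked-queries : ∀ B z {t qs b} → RunOn universalMachine B z t qs b → qs ≡ asks (parse z)
  asked-queries B z run = let _ , run′ , _ = universal-run B z in proj₁ (run-deterministic run run′)
  asks≤1 : ∀ m → length (asks m) ≤ 1
  asks≤1 nothing  = z≤n
  asks≤1 (just _) = ≤-refl
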